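{- (i) For every $n\ge 2$, the independence polynomial of the well-covered spider $S_n=K_{1,n}^*$ is $$I(S_n;x)=(1+x)\left\{1+\sum_{k=1}^{n}\left[\binom{n}{k}2^k+\binom{n-1}{k-1}\right]x^k\right\}.$$ (ii) If $G$ is a graph such that $G^*$ is connected, then the multiplicity of $-1$ as a root of $I(G^*;x)$ equals $1$ if and only if $G$ is isomorphic to $K_{1,n}$ for some $n\ge 1$. (iii) If $G$ is a graph such that $G^*$ is connected, $T$ is a well-covered spider, and $I(G^*;x)=I(T;x)$, then $G^*$ is isomorphic to $T$.
   Context: Graphs are finite and simple. A stable set is a set of pairwise non-adjacent vertices; with $s_k$ the number of stable sets of size $k$ ($s_0=1$), the independence polynomial is $I(G;x)=\sum_{k\ge0}s_kx^k$. For a graph $G$ with vertices $v_1,\dots,v_n$, $G^*$ is obtained by adding new vertices $u_1,\dots,u_n$ and edges $u_iv_i$, i.e., attaching one pendant edge to each vertex of $G$. $K_{1,n}$ is the star with $n$ leaves. A graph is well-covered if all its maximal stable sets have the same cardinality. A spider is a tree having at most one vertex of degree at least $3$. -}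

module Defs where

open import Data.Bool using (Bool; true; false; _∧_; _∨_; not)
open import Data.Nat as ℕ using (ℕ; zero; suc; _≥_)
open import Data.Nat.Combinatorics using (_C_)
open import Data.Integer as ℤ using (ℤ; +_)
open import Data.Fin using (Fin; zero; suc; splitAt; _≟_)
open import Data.Fin.Properties using (all?)
open import Data.Fin.Subset using (Subset; _∈_; _⊆_; ∣_∣; outside; inside)
open import Data.Fin.Subset.Properties using (_∈?_)
open import Data.Sum using (_⊎_; inj₁; inj₂)
open import Data.Product using (Σ; ∃; _×_; _,_)
open import Data.List as List using (List; []; _∷_; _++_; length; filter; upTo; map)
open import Data.List.Relation.Unary.Linked using (Linked)
open import Data.List.Relation.Unary.Unique.Propositional using (Unique)
open import Data.Vec using (Vec; []; _∷_)
open import Function.Bundles using (_↔_; Inverse)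
open import Relation.Nullary using (¬_; Dec; yes; no)
open import Relation.Nullary.Decidable using (⌊_⌋; _→-dec_; _×-dec_)
open import Relation.Binary.PropositionalEquality using (_≡_; refl; sym)
open import Data.Bool.Properties using () renaming (_≟_ to _≟ᵇ_)
open import Data.Nat.Properties using () renaming (_≟_ to _≟ⁿ_)

record Graph : Set where
  field
    size   : ℕ
    adj    : Fin size → Fin size → Bool
    adj-sym   : ∀ i j → adj i j ≡ adj j i
    adj-irrefl : ∀ i → adj i i ≡ false
open Graph public

Adj : (G : Graph) → Fin (size G) → Fin (size G) → Set
Adj G i j = adj G i j ≡ true

_≅_ : Graph → Graph → Set
G ≅ H = Σ (Fin (size G) ↔ Fin (size H)) λ f →
          ∀ i j → adj H (Inverse.to f i) (Inverse.to f j) ≡ adj G i j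

data Walk (G : Graph) : Fin (size G) → Fin (size G) → Set where
  nil  : ∀ {u} → Walk G u u
  cons : ∀ {u v w} → Adj G u v → Walk G v w → Walk G u w

Connected : Graph → Set
Connected G = ∀ u v → Walk G u v

HasCycle : Graph → Set
HasCycle G = Σ (Fin (size G)) λ v → Σ (List (Fin (size G))) λ rest →
  (length (v ∷ rest) ≥ 3) × Unique (v ∷ rest) × Linked (Adj G) ((v ∷ rest) ++ (v ∷ []))

IsTree : Graph → Set
IsTree G = Connected G × ¬ HasCycle G

degree : (G : Graph) → Fin (size G) → ℕ
degree G i = length (filter (λ j → adj G i j ≟ᵇ true) (List.allFin (size G)))

IsSpider : Graph → Set
IsSpider G = IsTree G × (∀ u v → degree G u ≥ 3 → degree G v ≥ 3 → u ≡ v)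

Stable : (G : Graph) → Subset (size G) → Set
Stable G S = ∀ i j → i ∈ S → j ∈ S → adj G i j ≡ false

stable? : (G : Graph) → (S : Subset (size G)) → Dec (Stable G S)
stable? G S = all? λ i → all? λ j →
  (i ∈? S) →-dec ((j ∈? S) →-dec (adj G i j ≟ᵇ false))

MaximalStable : (G : Graph) → Subset (size G) → Set
MaximalStable G S = Stable G S × (∀ T → Stable G T → S ⊆ T → T ≡ S)

WellCovered : Graph → Set
WellCovered G = ∀ S T → MaximalStable G S → MaximalStable G T → ∣ S ∣ ≡ ∣ T ∣

allSubsets : (n : ℕ) → List (Subset n)
allSubsets zero    = [] ∷ []
allSubsets (suc n) = map (inside ∷_) (allSubsets n) ++ map (outside ∷_) (allSubsets n)

stableCount : (G : Graph) → ℕ → ℕ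
stableCount G k =
  length (filter (λ S → stable? G S ×-dec (∣ S ∣ ≟ⁿ k)) (allSubsets (size G)))

-- polynomials with integer coefficients, as coefficient lists
-- (constant term first); equality is equality of all coefficients

Poly : Set
Poly = List ℤ

coeff : Poly → ℕ → ℤ
coeff []      _       = + 0
coeff (a ∷ p) zero    = a
coeff (a ∷ p) (suc k) = coeff p k

_≈P_ : Poly → Poly → Set
p ≈P q = ∀ k → coeff p k ≡ coeff q k

_+P_ : Poly → Poly → Poly
[]      +P q       = q
(a ∷ p) +P []      = a ∷ p
(a ∷ p) +P (b ∷ q) = (a ℤ.+ b) ∷ (p +P q)

_*P_ : Poly → Poly → Poly
[]      *P q = []
(a ∷ p) *P q = map (a ℤ.*_) q +P (+ 0 ∷ (p *P q))

_^P_ : Poly → ℕ → Poly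
p ^P zero  = + 1 ∷ []
p ^P suc m = p *P (p ^P m)

_∣P_ : Poly → Poly → Set
p ∣P q = ∃ λ r → (p *P r) ≈P q

X-_ : ℤ → Poly
X- a = ℤ.- a ∷ + 1 ∷ []

RootMultiplicity : Poly → ℤ → ℕ → Set
RootMultiplicity p a m = ((X- a) ^P m) ∣P p × ¬ (((X- a) ^P suc m) ∣P p)

-- independence polynomial I(G;x) = Σ_k s_k x^k  (s_k = 0 for k > |V|)
indepPoly : Graph → Poly
indepPoly G = map (λ k → + stableCount G k) (upTo (suc (size G)))

starAdj : ∀ {n} → Fin (suc n) → Fin (suc n) → Bool
starAdj zero    zero    = false
starAdj zero    (suc _) = true
starAdj (suc _) zero    = true
starAdj (suc _) (suc _) = false

starAdj-sym : ∀ {n} (i j : Fin (suc n)) → starAdj i j ≡ starAdj j i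
starAdj-sym zero    zero    = refl
starAdj-sym zero    (suc _) = refl
starAdj-sym (suc _) zero    = refl
starAdj-sym (suc _) (suc _) = refl

starAdj-irrefl : ∀ {n} (i : Fin (suc n)) → starAdj i i ≡ false
starAdj-irrefl zero    = refl
starAdj-irrefl (suc _) = refl

K1,_ : ℕ → Graph
K1, n = record { size = suc n ; adj = starAdj ; adj-sym = starAdj-sym
               ; adj-irrefl = starAdj-irrefl }

eqB : ∀ {n} → Fin n → Fin n → Bool
eqB i j = ⌊ i ≟ j ⌋

eqB-sym : ∀ {n} (i j : Fin n) → eqB i j ≡ eqB j i
eqB-sym i j with i ≟ j | j ≟ i
... | yes _ | yes _ = refl
... | no  _ | no  _ = refl
... | yes p | no ¬q = Data.Empty.⊥-elim (¬q (sym p)) where import Data.Empty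
... | no ¬p | yes q = Data.Empty.⊥-elim (¬p (sym q)) where import Data.Empty

module _ (G : Graph) where
  private n = size G

  corAdj : Fin n ⊎ Fin n → Fin n ⊎ Fin n → Bool
  corAdj (inj₁ i) (inj₁ j) = adj G i j
  corAdj (inj₁ i) (inj₂ j) = eqB i j
  corAdj (inj₂ i) (inj₁ j) = eqB i j
  corAdj (inj₂ i) (inj₂ j) = false

  corAdj-sym : ∀ x y → corAdj x y ≡ corAdj y x
  corAdj-sym (inj₁ i) (inj₁ j) = adj-sym G i j
  corAdj-sym (inj₁ i) (inj₂ j) = eqB-sym i j
  corAdj-sym (inj₂ i) (inj₁ j) = eqB-sym i j
  corAdj-sym (inj₂ i) (inj₂ j) = refl

  corAdj-irrefl : ∀ x → corAdj x x ≡ false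
  corAdj-irrefl (inj₁ i) = adj-irrefl G i
  corAdj-irrefl (inj₂ i) = refl

  corona : Graph
  corona = record
    { size = n ℕ.+ n
    ; adj = λ i j → corAdj (splitAt n i) (splitAt n j)
    ; adj-sym = λ i j → corAdj-sym (splitAt n i) (splitAt n j)
    ; adj-irrefl = λ i → corAdj-irrefl (splitAt n i)
    }

_* : Graph → Graph
G * = corona G

spiderFactor : ℕ → Poly
spiderFactor n = + 1 ∷ map (λ j → let k = suc j in
                    + ((n C k) ℕ.* (2 ℕ.^ k) ℕ.+ ((n ℕ.∸ 1) C (k ℕ.∸ 1))))
                    (upTo n)

onePlusX : Poly
onePlusX = + 1 ∷ + 1 ∷ []

{-# OPTIONS --safe #-}
module Submission where

-- A stable set of G* is a stable set A of G together with pendant vertices hanging off the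
-- complement of A, so I(G*) = Σ_A x^|A| (1+x)^(n−|A|) with n = |G|, and −1 is a root of
-- multiplicity n − α(G).  The multiplicity is 1 exactly when one vertex meets every edge while
-- some edge exists, which for connected G* means that G is a star.  All this is carried out
-- dually: a weight w : ℕ → ℤ acts on polynomials by xᵏ ↦ w k, and multiplication by 1 + cx
-- becomes the operator u ↦ (a ↦ u a + c u(a+1)) on weights.
--
-- For (iii), the polynomial shows that T has 2n vertices and that its largest stable sets have
-- n elements.  Repeatedly deleting a vertex of degree at most 1 (with its neighbour) from the
-- forest then yields a perfect matching.  Well-coveredness forces each matching edge to contain
-- a leaf, so T = H* for a tree H; at most one branch vertex makes H a star, and (ii) applies.

open import Defs
import Algebra.Properties.CommutativeMonoid.Sum
open import Data.Bool using (Bool; true; false; if_then_else_; _∧_)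
open import Data.Bool.Properties using (¬-not) renaming (_≟_ to _≟ᵇ_)
open import Data.Fin using (Fin; zero; suc; splitAt; _↑ˡ_; _↑ʳ_; join; punchIn; punchOut)
open import Data.Fin.Permutation using (↔⇒≡)
open import Data.Fin.Properties using (all?; any?; splitAt-↑ˡ; splitAt-↑ʳ; join-splitAt; splitAt-join; punchInᵢ≢i; punchIn-injective; punchIn-punchOut) renaming (_≟_ to _≟ᶠ_)
open import Data.Fin.Subset using (Subset; inside; outside; _∈_; _∉_; _⊆_; _⊂_; ∣_∣; ∁; ⊥; ⊤; ⁅_⁆; _∪_; _-_; Nonempty)
open import Data.Fin.Subset.Properties
open import Data.Integer using (ℤ; +_; -[1+_]; _+_; -_; 0ℤ; 1ℤ) renaming (_*_ to _·_)
import Data.Integer.Properties as ℤₚ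
open import Data.Integer.Tactic.RingSolver using (solve-∀)
open import Data.List as List using (List; []; _∷_; length; filter; map; upTo; applyUpTo; allFin)
import Data.List.Membership.DecPropositional as DecMembership
open import Data.List.Membership.Propositional using () renaming (_∈_ to _∈ˡ_)
open import Data.List.Membership.Propositional.Properties using (∈-∃++; ∈-++⁺ˡ; ∈-++⁺ʳ; ∈-++⁻; ∈-map⁺; ∈-map⁻; ∈-filter⁺; ∈-filter⁻; ∈-length; ∈-allFin; ∈-lookup)
open import Data.List.Properties using (length-++; filter-++; length-map; length-tabulate)
open import Data.List.Relation.Unary.All as All using (All; []; _∷_)
import Data.List.Relation.Unary.All.Properties as All
open import Data.List.Relation.Unary.Any as Any using (here; there)
open import Data.List.Relation.Unary.Any.Properties using (lookup-index)
open import Data.List.Relation.Unary.Linked using (Linked; [-]; _∷_)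
open import Data.List.Relation.Unary.Unique.Propositional using (Unique; []; _∷_)
import Data.List.Relation.Unary.Unique.Propositional.Properties as Unique
open import Data.Nat as ℕ using (ℕ; zero; suc; _≤_; _<_; _≥_; z≤n; s≤s; _∸_)
open import Data.Nat.Combinatorics using (_C_; nCk+nC[k+1]≡[n+1]C[k+1]; k>n⇒nCk≡0; nC1≡n)
import Data.Nat.Properties as ℕₚ
open import Data.Nat.Tactic.RingSolver using () renaming (solve-∀ to solveℕ-∀)
open import Data.Product using (Σ; ∃; _×_; _,_; proj₁; proj₂; map₂)
open import Data.Sum as Sum using (_⊎_; inj₁; inj₂; [_,_]′)
open import Data.Vec as Vec using ([]; _∷_; here; there)
open import Data.Vec.Properties using (lookup∘tabulate; []=⇒lookup; lookup⇒[]=; tabulate∘lookup; ∷-injectiveʳ)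
open import Function using (_∘_; id)
open import Function.Bundles using (_⇔_; mk⇔; _↔_; mk↔ₛ′; Inverse; Equivalence)
open import Function.Properties.Inverse using (↔-sym; ↔-trans)
open import Level using (0ℓ)
open import Relation.Binary.PropositionalEquality
open import Relation.Nullary using (¬_; Dec; yes; no; does; contradiction)
open import Relation.Nullary.Decidable using (_→-dec_; _×-dec_; ¬?; does-⇔; dec-true; dec-false; decidable-stable)
open import Relation.Unary using (Pred; Decidable)

-- Sums over subsets

-- Polynomials are coefficient lists compared by `_≈P_`, under which rearranging sums of products is
-- laborious; a functional turns each identity into one between integer sums over subsets. Three
-- weights suffice: `δ k` reads the coefficient of x^k, `sgn` the value at -1, and `index·sgn` minus
-- the derivative at -1. In Σ_A x^|A| (1+x)^(n-|A|), a term with d factors 1+x vanishes to order d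
-- at -1, so the last two weights see only those A that omit at most one vertex. Omitting none means
-- that G has no edge, omitting just v means that v meets every edge; this is how a simple root
-- singles out a vertex. In (iii), the bound on stable sets is what keeps isolated vertices from
-- appearing during the deletion: each would push the greedily built stable set beyond half of the
-- vertices. The empty graph and K_{1,0} have no root -1 to argue with and are treated apart.

Σ⊆ : ∀ n → (Subset n → ℤ) → ℤ
Σ⊆ zero    f = f []
Σ⊆ (suc n) f = Σ⊆ n (λ S → f (inside ∷ S)) + Σ⊆ n (λ S → f (outside ∷ S))

Σ⊆-cong : ∀ n {f g : Subset n → ℤ} → (∀ S → f S ≡ g S) → Σ⊆ n f ≡ Σ⊆ n g
Σ⊆-cong zero    f≗g = f≗g []
Σ⊆-cong (suc n) f≗g = cong₂ _+_ (Σ⊆-cong n (f≗g ∘ (inside ∷_))) (Σ⊆-cong n (f≗g ∘ (outside ∷_)))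

Σ⊆-zero : ∀ n {f : Subset n → ℤ} → (∀ S → f S ≡ 0ℤ) → Σ⊆ n f ≡ 0ℤ
Σ⊆-zero zero    f≗0 = f≗0 []
Σ⊆-zero (suc n) f≗0 = cong₂ _+_ (Σ⊆-zero n (f≗0 ∘ (inside ∷_))) (Σ⊆-zero n (f≗0 ∘ (outside ∷_)))

Σ⊆-single : ∀ n {f : Subset n → ℤ} T → (∀ S → S ≢ T → f S ≡ 0ℤ) → Σ⊆ n f ≡ f T
Σ⊆-single zero    []            _   = refl
Σ⊆-single (suc n) (inside  ∷ T) f≗0 =
  trans (cong₂ _+_ (Σ⊆-single n T (λ S S≢T → f≗0 (inside ∷ S) λ { refl → S≢T refl }))
                   (Σ⊆-zero n (λ S → f≗0 (outside ∷ S) λ ())))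
        (ℤₚ.+-identityʳ _)
Σ⊆-single (suc n) (outside ∷ T) f≗0 =
  trans (cong₂ _+_ (Σ⊆-zero n (λ S → f≗0 (inside ∷ S) λ ()))
                   (Σ⊆-single n T (λ S S≢T → f≗0 (outside ∷ S) λ { refl → S≢T refl })))
        (ℤₚ.+-identityˡ _)

Σ⊆-++ : ∀ m n (f : Subset (m ℕ.+ n) → ℤ) →
        Σ⊆ (m ℕ.+ n) f ≡ Σ⊆ m (λ A → Σ⊆ n (λ B → f (A Vec.++ B)))
Σ⊆-++ zero    n f = refl
Σ⊆-++ (suc m) n f = cong₂ _+_ (Σ⊆-++ m n (f ∘ (inside ∷_))) (Σ⊆-++ m n (f ∘ (outside ∷_)))

length-filter-map : ∀ {A B : Set} {P : Pred B 0ℓ} (P? : Decidable P) (f : A → B) xs →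
                    length (filter P? (map f xs)) ≡ length (filter (P? ∘ f) xs)
length-filter-map P? f []       = refl
length-filter-map P? f (x ∷ xs) with does (P? (f x))
... | true  = cong suc (length-filter-map P? f xs)
... | false = length-filter-map P? f xs

-- Replaces the list-based count by an indicator sum, which splits element by element.
length-filter-allSubsets : ∀ n {P : Pred (Subset n) 0ℓ} (P? : Decidable P) →
  + length (filter P? (allSubsets n)) ≡ Σ⊆ n (λ S → if does (P? S) then 1ℤ else 0ℤ)
length-filter-allSubsets zero P? with does (P? [])
... | true  = refl
... | false = refl
length-filter-allSubsets (suc n) P? = begin
  + length (filter P? (ins List.++ outs))
    ≡⟨ cong (+_ ∘ length) (filter-++ P? ins outs) ⟩
  + length (filter P? ins List.++ filter P? outs)
    ≡⟨ cong +_ (length-++ (filter P? ins)) ⟩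
  + length (filter P? ins) + + length (filter P? outs)
    ≡⟨ cong₂ (λ a b → + a + + b) (length-filter-map P? (inside ∷_) (allSubsets n))
                                 (length-filter-map P? (outside ∷_) (allSubsets n)) ⟩
  + length (filter (P? ∘ (inside ∷_)) (allSubsets n)) + + length (filter (P? ∘ (outside ∷_)) (allSubsets n))
    ≡⟨ cong₂ _+_ (length-filter-allSubsets n (P? ∘ (inside ∷_)))
                 (length-filter-allSubsets n (P? ∘ (outside ∷_))) ⟩
  Σ⊆ (suc n) (λ S → if does (P? S) then 1ℤ else 0ℤ) ∎
  where
  open ≡-Reasoning
  ins  = map (inside ∷_) (allSubsets n)
  outs = map (outside ∷_) (allSubsets n)

-- The operators u ↦ u + c (shift u)

step : ℤ → (ℕ → ℤ) → ℕ → ℤ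
step c u a = u a + c · u (suc a)

-- `steps c m u a` is the weight `u` applied to x^a (1+cx)^m.
steps : ℤ → ℕ → (ℕ → ℤ) → ℕ → ℤ
steps c zero    u = u
steps c (suc m) u = steps c m (step c u)

steps-cong : ∀ c m {u v} → (∀ a → u a ≡ v a) → ∀ a → steps c m u a ≡ steps c m v a
steps-cong c zero    u≗v = u≗v
steps-cong c (suc m) u≗v = steps-cong c m (λ a → cong₂ (λ x y → x + c · y) (u≗v a) (u≗v (suc a)))

steps-zero : ∀ c m {u} → (∀ a → u a ≡ 0ℤ) → ∀ a → steps c m u a ≡ 0ℤ
steps-zero c zero    u≗0 = u≗0
steps-zero c (suc m) u≗0 = steps-zero c m λ a →
  trans (cong₂ (λ x y → x + c · y) (u≗0 a) (u≗0 (suc a))) (trans (ℤₚ.+-identityˡ _) (ℤₚ.*-zeroʳ c))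

steps-+ : ∀ c m u v a → steps c m (λ b → u b + v b) a ≡ steps c m u a + steps c m v a
steps-+ c zero    u v a = refl
steps-+ c (suc m) u v a =
  trans (steps-cong c m (λ b → lemma c (u b) (v b) (u (suc b)) (v (suc b))) a)
        (steps-+ c m (step c u) (step c v) a)
  where
  lemma : ∀ c x y x′ y′ → (x + y) + c · (x′ + y′) ≡ (x + c · x′) + (y + c · y′)
  lemma = solve-∀

steps-* : ∀ c m r u a → steps c m (λ b → r · u b) a ≡ r · steps c m u a
steps-* c zero    r u a = refl
steps-* c (suc m) r u a =
  trans (steps-cong c m (λ b → lemma c r (u b) (u (suc b))) a) (steps-* c m r (step c u) a)
  where
  lemma : ∀ c r x x′ → r · x + c · (r · x′) ≡ r · (x + c · x′)
  lemma = solve-∀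

δ : ℕ → ℕ → ℤ
δ k j = if does (j ℕ.≟ k) then 1ℤ else 0ℤ

-- The binomial theorem for (1+cx)^m, read at x^k. Shifting `δ (suc k)` gives `δ k`, so the
-- inductive step is Pascal's rule.
steps-δ : ∀ c m k → steps (+ c) m (δ k) 0 ≡ + ((m C k) ℕ.* c ℕ.^ k)
steps-δ c zero    zero    = refl
steps-δ c zero    (suc k) = refl
steps-δ c (suc m) zero    = begin
  steps (+ c) m (step (+ c) (δ 0)) 0  ≡⟨ steps-cong (+ c) m (λ a → trans (cong (_+_ (δ 0 a)) (ℤₚ.*-zeroʳ (+ c))) (ℤₚ.+-identityʳ _)) 0 ⟩
  steps (+ c) m (δ 0) 0               ≡⟨ steps-δ c m 0 ⟩
  + ((m C 0) ℕ.* 1)                   ∎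
  where open ≡-Reasoning
steps-δ c (suc m) (suc k) = begin
  steps (+ c) m (step (+ c) (δ (suc k))) 0
    ≡⟨ steps-+ (+ c) m (δ (suc k)) (λ a → + c · δ k a) 0 ⟩
  steps (+ c) m (δ (suc k)) 0 + steps (+ c) m (λ a → + c · δ k a) 0
    ≡⟨ cong₂ _+_ (steps-δ c m (suc k)) (trans (steps-* (+ c) m (+ c) (δ k) 0) (cong (+ c ·_) (steps-δ c m k))) ⟩
  + ((m C suc k) ℕ.* c ℕ.^ suc k) + + c · + ((m C k) ℕ.* c ℕ.^ k)
    ≡⟨ cong (_+_ (+ ((m C suc k) ℕ.* c ℕ.^ suc k))) (sym (ℤₚ.pos-* c ((m C k) ℕ.* c ℕ.^ k))) ⟩
  + ((m C suc k) ℕ.* c ℕ.^ suc k ℕ.+ c ℕ.* ((m C k) ℕ.* c ℕ.^ k))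
    ≡⟨ cong +_ lemma ⟩
  + ((suc m C suc k) ℕ.* c ℕ.^ suc k) ∎
  where
  open ≡-Reasoning
  lemma : (m C suc k) ℕ.* c ℕ.^ suc k ℕ.+ c ℕ.* ((m C k) ℕ.* c ℕ.^ k) ≡ (suc m C suc k) ℕ.* c ℕ.^ suc k
  lemma = begin
    (m C suc k) ℕ.* c ℕ.^ suc k ℕ.+ c ℕ.* ((m C k) ℕ.* c ℕ.^ k)
      ≡⟨ cong ((m C suc k) ℕ.* c ℕ.^ suc k ℕ.+_) (trans (sym (ℕₚ.*-assoc c (m C k) _))
           (trans (cong (ℕ._* c ℕ.^ k) (ℕₚ.*-comm c (m C k))) (ℕₚ.*-assoc (m C k) c _))) ⟩
    (m C suc k) ℕ.* c ℕ.^ suc k ℕ.+ (m C k) ℕ.* c ℕ.^ suc k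
      ≡⟨ ℕₚ.*-distribʳ-+ (c ℕ.^ suc k) (m C suc k) (m C k) ⟨
    (m C suc k ℕ.+ m C k) ℕ.* c ℕ.^ suc k
      ≡⟨ cong (ℕ._* c ℕ.^ suc k) (trans (ℕₚ.+-comm (m C suc k) (m C k)) (nCk+nC[k+1]≡[n+1]C[k+1] m k)) ⟩
    (suc m C suc k) ℕ.* c ℕ.^ suc k ∎

-- Linear functionals on polynomials

⟪_,_⟫ : (ℕ → ℤ) → Poly → ℤ
⟪ w , []    ⟫ = 0ℤ
⟪ w , a ∷ p ⟫ = a · w 0 + ⟪ w ∘ suc , p ⟫

-- Lists equal under `_≈P_` may differ in trailing zeros; this covers the surplus when one list ends
-- before the other.
⟪⟫-≈0 : ∀ w p → (∀ k → coeff p k ≡ 0ℤ) → ⟪ w , p ⟫ ≡ 0ℤ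
⟪⟫-≈0 w []      p≈0 = refl
⟪⟫-≈0 w (a ∷ p) p≈0 = cong₂ _+_ (cong (_· w 0) (p≈0 0)) (⟪⟫-≈0 (w ∘ suc) p (p≈0 ∘ suc))

⟪⟫-cong : ∀ w {p q} → p ≈P q → ⟪ w , p ⟫ ≡ ⟪ w , q ⟫
⟪⟫-cong w {[]}    {q}     p≈q = sym (⟪⟫-≈0 w q (sym ∘ p≈q))
⟪⟫-cong w {a ∷ p} {[]}    p≈q = ⟪⟫-≈0 w (a ∷ p) p≈q
⟪⟫-cong w {a ∷ p} {b ∷ q} p≈q = cong₂ _+_ (cong (_· w 0) (p≈q 0)) (⟪⟫-cong (w ∘ suc) {p} {q} (p≈q ∘ suc))

⟪⟫-congˡ : ∀ {w v} p → (∀ k → w k ≡ v k) → ⟪ w , p ⟫ ≡ ⟪ v , p ⟫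
⟪⟫-congˡ []      w≗v = refl
⟪⟫-congˡ (a ∷ p) w≗v = cong₂ _+_ (cong (a ·_) (w≗v 0)) (⟪⟫-congˡ p (w≗v ∘ suc))

⟪⟫-zeroˡ : ∀ {w} p → (∀ k → w k ≡ 0ℤ) → ⟪ w , p ⟫ ≡ 0ℤ
⟪⟫-zeroˡ []      w≗0 = refl
⟪⟫-zeroˡ (a ∷ p) w≗0 = cong₂ _+_ (trans (cong (a ·_) (w≗0 0)) (ℤₚ.*-zeroʳ a)) (⟪⟫-zeroˡ p (w≗0 ∘ suc))

⟪⟫-negˡ : ∀ w p → ⟪ (λ k → - w k) , p ⟫ ≡ - ⟪ w , p ⟫
⟪⟫-negˡ w []      = refl
⟪⟫-negˡ w (a ∷ p) = trans (cong (_+_ (a · - w 0)) (⟪⟫-negˡ (w ∘ suc) p)) (lemma a (w 0) ⟪ w ∘ suc , p ⟫)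
  where
  lemma : ∀ x y z → x · - y + - z ≡ - (x · y + z)
  lemma = solve-∀

⟪⟫-step : ∀ c w p → ⟪ step c w , p ⟫ ≡ ⟪ w , p ⟫ + c · ⟪ w ∘ suc , p ⟫
⟪⟫-step c w []      = sym (trans (ℤₚ.+-identityˡ _) (ℤₚ.*-zeroʳ c))
⟪⟫-step c w (a ∷ p) = trans (cong (_+_ (a · step c w 0)) (⟪⟫-step c (w ∘ suc) p))
                            (lemma a c (w 0) (w 1) ⟪ w ∘ suc , p ⟫ ⟪ (λ j → w (suc (suc j))) , p ⟫)
  where
  lemma : ∀ a c x y s t → a · (x + c · y) + (s + c · t) ≡ (a · x + s) + c · (a · y + t)
  lemma = solve-∀

⟪⟫-+P : ∀ w p q → ⟪ w , p +P q ⟫ ≡ ⟪ w , p ⟫ + ⟪ w , q ⟫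
⟪⟫-+P w []      q       = sym (ℤₚ.+-identityˡ _)
⟪⟫-+P w (a ∷ p) []      = sym (ℤₚ.+-identityʳ _)
⟪⟫-+P w (a ∷ p) (b ∷ q) = trans (cong (_+_ ((a + b) · w 0)) (⟪⟫-+P (w ∘ suc) p q))
                                (lemma a b (w 0) ⟪ w ∘ suc , p ⟫ ⟪ w ∘ suc , q ⟫)
  where
  lemma : ∀ a b x s t → (a + b) · x + (s + t) ≡ (a · x + s) + (b · x + t)
  lemma = solve-∀

-- Coefficients of sums and of products with 1 + x

coeff-+P : ∀ p q k → coeff (p +P q) k ≡ coeff p k + coeff q k
coeff-+P []      q       k       = sym (ℤₚ.+-identityˡ _)
coeff-+P (a ∷ p) []      k       = sym (ℤₚ.+-identityʳ _)
coeff-+P (a ∷ p) (b ∷ q) zero    = refl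
coeff-+P (a ∷ p) (b ∷ q) (suc k) = coeff-+P p q k

coeff-scale : ∀ a p k → coeff (map (a ·_) p) k ≡ a · coeff p k
coeff-scale a []      k       = sym (ℤₚ.*-zeroʳ a)
coeff-scale a (b ∷ p) zero    = refl
coeff-scale a (b ∷ p) (suc k) = coeff-scale a p k

coeff-*P-zero : ∀ a p q → coeff ((a ∷ p) *P q) 0 ≡ a · coeff q 0
coeff-*P-zero a p q = trans (coeff-+P (map (a ·_) q) _ 0) (trans (ℤₚ.+-identityʳ _) (coeff-scale a q 0))

coeff-*P-suc : ∀ a p q k → coeff ((a ∷ p) *P q) (suc k) ≡ a · coeff q (suc k) + coeff (p *P q) k
coeff-*P-suc a p q k = trans (coeff-+P (map (a ·_) q) _ (suc k)) (cong (_+ _) (coeff-scale a q (suc k)))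

coeff-onePlusX-zero : ∀ q → coeff (onePlusX *P q) 0 ≡ coeff q 0
coeff-onePlusX-zero q = trans (coeff-*P-zero 1ℤ (1ℤ ∷ []) q) (ℤₚ.*-identityˡ _)

coeff-const : ∀ a q k → coeff ((a ∷ []) *P q) k ≡ a · coeff q k
coeff-const a q zero    = coeff-*P-zero a [] q
coeff-const a q (suc k) = trans (coeff-*P-suc a [] q k) (ℤₚ.+-identityʳ _)

coeff-onePlusX-suc : ∀ q k → coeff (onePlusX *P q) (suc k) ≡ coeff q (suc k) + coeff q k
coeff-onePlusX-suc q k = trans (coeff-*P-suc 1ℤ (1ℤ ∷ []) q k)
  (cong₂ _+_ (ℤₚ.*-identityˡ (coeff q (suc k))) (trans (coeff-const 1ℤ q k) (ℤₚ.*-identityˡ (coeff q k))))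

onePlusX-cong : ∀ {p q} → p ≈P q → (onePlusX *P p) ≈P (onePlusX *P q)
onePlusX-cong {p} {q} p≈q zero    =
  trans (coeff-onePlusX-zero p) (trans (p≈q 0) (sym (coeff-onePlusX-zero q)))
onePlusX-cong {p} {q} p≈q (suc k) =
  trans (coeff-onePlusX-suc p k)
        (trans (cong₂ _+_ (p≈q (suc k)) (p≈q k)) (sym (coeff-onePlusX-suc q k)))

-- This one instance of associativity links the square in `RootMultiplicity` to two divisions by 1 +
-- x. It is checked coefficientwise, as `onePlusX ^P 2` evaluates to the list 1, 2, 1.
onePlusX²-assoc : ∀ r → ((onePlusX ^P 2) *P r) ≈P (onePlusX *P (onePlusX *P r))
onePlusX²-assoc r zero =
  trans (coeff-*P-zero 1ℤ (+ 2 ∷ 1ℤ ∷ []) r) (trans (ℤₚ.*-identityˡ _)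
    (sym (trans (coeff-onePlusX-zero (onePlusX *P r)) (coeff-onePlusX-zero r))))
onePlusX²-assoc r (suc zero) =
  trans (coeff-*P-suc 1ℤ (+ 2 ∷ 1ℤ ∷ []) r 0) (trans (cong (_+_ (1ℤ · coeff r 1)) (coeff-*P-zero (+ 2) (1ℤ ∷ []) r))
    (trans (lemma (coeff r 1) (coeff r 0))
    (sym (trans (coeff-onePlusX-suc (onePlusX *P r) 0)
                (cong₂ _+_ (coeff-onePlusX-suc r 0) (coeff-onePlusX-zero r))))))
  where
  lemma : ∀ x y → + 1 · x + + 2 · y ≡ (x + y) + y
  lemma = solve-∀
onePlusX²-assoc r (suc (suc k)) =
  trans (coeff-*P-suc 1ℤ (+ 2 ∷ 1ℤ ∷ []) r (suc k))
    (trans (cong (_+_ (1ℤ · coeff r (suc (suc k))))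
      (trans (coeff-*P-suc (+ 2) (1ℤ ∷ []) r k) (cong (_+_ (+ 2 · coeff r (suc k))) (coeff-const 1ℤ r k))))
    (trans (lemma (coeff r (suc (suc k))) (coeff r (suc k)) (coeff r k))
    (sym (trans (coeff-onePlusX-suc (onePlusX *P r) (suc k))
                (cong₂ _+_ (coeff-onePlusX-suc r (suc k)) (coeff-onePlusX-suc r k))))))
  where
  lemma : ∀ x y z → + 1 · x + (+ 2 · y + + 1 · z) ≡ (x + y) + (y + z)
  lemma = solve-∀

⟪⟫-shift : ∀ w q → ⟪ w , onePlusX *P q ⟫ ≡ ⟪ step 1ℤ w , q ⟫
⟪⟫-shift w q = begin
  ⟪ w , onePlusX *P q ⟫                ≡⟨ ⟪⟫-cong w {onePlusX *P q} {q +P (0ℤ ∷ q)} eq ⟩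
  ⟪ w , q +P (0ℤ ∷ q) ⟫                ≡⟨ ⟪⟫-+P w q (0ℤ ∷ q) ⟩
  ⟪ w , q ⟫ + (0ℤ + ⟪ w ∘ suc , q ⟫)   ≡⟨ cong (_+_ (⟪ w , q ⟫)) (trans (ℤₚ.+-identityˡ _) (sym (ℤₚ.*-identityˡ _))) ⟩
  ⟪ w , q ⟫ + 1ℤ · ⟪ w ∘ suc , q ⟫     ≡⟨ ⟪⟫-step 1ℤ w q ⟨
  ⟪ step 1ℤ w , q ⟫                    ∎
  where
  open ≡-Reasoning
  eq : (onePlusX *P q) ≈P (q +P (0ℤ ∷ q))
  eq zero    = trans (coeff-onePlusX-zero q) (sym (trans (coeff-+P q (0ℤ ∷ q) 0) (ℤₚ.+-identityʳ _)))
  eq (suc k) = trans (coeff-onePlusX-suc q k) (sym (coeff-+P q (0ℤ ∷ q) (suc k)))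

-- The root −1

sgn : ℕ → ℤ
sgn zero    = 1ℤ
sgn (suc k) = - sgn k

index·sgn : ℕ → ℤ
index·sgn k = + k · sgn k

step-sgn : ∀ a → step 1ℤ sgn a ≡ 0ℤ
step-sgn a = lemma (sgn a)
  where
  lemma : ∀ x → x + + 1 · (- x) ≡ + 0
  lemma = solve-∀

-- The product rule at -1: the derivative of (1+x)q there is q(-1).
step-index·sgn : ∀ a → step 1ℤ index·sgn a ≡ - sgn a
step-index·sgn a = trans (cong (λ z → index·sgn a + 1ℤ · (z · - sgn a)) (ℤₚ.pos-+ 1 a)) (lemma (+ a) (sgn a))
  where
  lemma : ∀ n x → n · x + + 1 · ((+ 1 + n) · - x) ≡ - x
  lemma = solve-∀

-- Synthetic division by x + 1: a quotient coefficient is the value at -1 of the part of the list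
-- above it. The trailing 0 this produces is invisible to `_≈P_`.
divX+1 : Poly → Poly
divX+1 []      = []
divX+1 (a ∷ p) = ⟪ sgn , p ⟫ ∷ divX+1 p

-- The remainder p(-1) enters division by x + 1 only in the constant term; the higher coefficients
-- match without it.
divX+1-zero : ∀ p → coeff (divX+1 p) 0 + ⟪ sgn , p ⟫ ≡ coeff p 0
divX+1-zero []      = refl
divX+1-zero (a ∷ p) = trans (cong (λ z → ⟪ sgn , p ⟫ + (a · 1ℤ + z)) (⟪⟫-negˡ sgn p)) (lemma a ⟪ sgn , p ⟫)
  where
  lemma : ∀ a x → x + (a · + 1 + - x) ≡ a
  lemma = solve-∀

divX+1-suc : ∀ p k → coeff (divX+1 p) (suc k) + coeff (divX+1 p) k ≡ coeff p (suc k)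
divX+1-suc []      k       = refl
divX+1-suc (a ∷ p) zero    = divX+1-zero p
divX+1-suc (a ∷ p) (suc k) = divX+1-suc p k

onePlusX*divX+1 : ∀ p → ⟪ sgn , p ⟫ ≡ 0ℤ → (onePlusX *P divX+1 p) ≈P p
onePlusX*divX+1 p p[-1]≡0 zero    = begin
  coeff (onePlusX *P divX+1 p) 0       ≡⟨ coeff-onePlusX-zero (divX+1 p) ⟩
  coeff (divX+1 p) 0                   ≡⟨ ℤₚ.+-identityʳ _ ⟨
  coeff (divX+1 p) 0 + 0ℤ              ≡⟨ cong (_+_ (coeff (divX+1 p) 0)) p[-1]≡0 ⟨
  coeff (divX+1 p) 0 + ⟪ sgn , p ⟫     ≡⟨ divX+1-zero p ⟩
  coeff p 0                            ∎
  where open ≡-Reasoning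
onePlusX*divX+1 p p[-1]≡0 (suc k) = trans (coeff-onePlusX-suc (divX+1 p) k) (divX+1-suc p k)

⟪sgn,onePlusX*⟫ : ∀ q → ⟪ sgn , onePlusX *P q ⟫ ≡ 0ℤ
⟪sgn,onePlusX*⟫ q = trans (⟪⟫-shift sgn q) (⟪⟫-zeroˡ q step-sgn)

⟪index·sgn,onePlusX*⟫ : ∀ q → ⟪ index·sgn , onePlusX *P q ⟫ ≡ - ⟪ sgn , q ⟫
⟪index·sgn,onePlusX*⟫ q =
  trans (⟪⟫-shift index·sgn q) (trans (⟪⟫-congˡ q step-index·sgn) (⟪⟫-negˡ sgn q))

-- ⟪ sgn , p ⟫ is p(−1), and ⟪ index·sgn , p ⟫ is −p′(−1).
simpleRoot⇒ : ∀ p → RootMultiplicity p -[1+ 0 ] 1 → ⟪ sgn , p ⟫ ≡ 0ℤ × ⟪ index·sgn , p ⟫ ≢ 0ℤ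
simpleRoot⇒ p ((q , 1+X*q≈p) , ¬[1+X]²∣p) = p[-1]≡0 , λ p′[-1]≡0 →
  -- If the derivative vanished as well, the first quotient would again have the root -1, and
  -- synthetic division would succeed twice.
  ¬[1+X]²∣p (divX+1 (divX+1 p) , λ k →
    trans (onePlusX²-assoc (divX+1 (divX+1 p)) k)
      (trans (onePlusX-cong {onePlusX *P divX+1 (divX+1 p)} {divX+1 p} (onePlusX*divX+1 (divX+1 p) (quotient-root p′[-1]≡0)) k)
             (onePlusX*divX+1 p p[-1]≡0 k)))
  where
  p[-1]≡0 : ⟪ sgn , p ⟫ ≡ 0ℤ
  p[-1]≡0 = trans (sym (⟪⟫-cong sgn {onePlusX *P q} {p} 1+X*q≈p)) (⟪sgn,onePlusX*⟫ q)
  quotient-root : ⟪ index·sgn , p ⟫ ≡ 0ℤ → ⟪ sgn , divX+1 p ⟫ ≡ 0ℤ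
  quotient-root p′[-1]≡0 = ℤₚ.neg-injective
    (trans (sym (⟪index·sgn,onePlusX*⟫ (divX+1 p)))
           (trans (⟪⟫-cong index·sgn {onePlusX *P divX+1 p} {p} (onePlusX*divX+1 p p[-1]≡0)) p′[-1]≡0))

simpleRoot⇐ : ∀ p → ⟪ sgn , p ⟫ ≡ 0ℤ → ⟪ index·sgn , p ⟫ ≢ 0ℤ → RootMultiplicity p -[1+ 0 ] 1
simpleRoot⇐ p p[-1]≡0 p′[-1]≢0 = (divX+1 p , onePlusX*divX+1 p p[-1]≡0) , λ (r , [1+X]²*r≈p) →
  p′[-1]≢0 (trans (⟪⟫-cong index·sgn {p} {onePlusX *P (onePlusX *P r)} (λ k → trans (sym ([1+X]²*r≈p k)) (onePlusX²-assoc r k)))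
           (trans (⟪index·sgn,onePlusX*⟫ (onePlusX *P r)) (cong -_ (⟪sgn,onePlusX*⟫ r))))

simpleRoot-cong : ∀ {p q} → p ≈P q → RootMultiplicity p -[1+ 0 ] 1 → RootMultiplicity q -[1+ 0 ] 1
simpleRoot-cong p≈q ((r , r≈p) , ¬∣) = (r , λ k → trans (r≈p k) (p≈q k)) , λ (s , s≈q) → ¬∣ (s , λ k → trans (s≈q k) (sym (p≈q k)))

-- The independence polynomial as a sum over stable sets

weightSum : (ℕ → ℤ) → Graph → ℤ
weightSum w G = Σ⊆ (size G) (λ S → if does (stable? G S) then w ∣ S ∣ else 0ℤ)

-- Intermediary between `indepPoly`, which is known by its coefficients, and `weightSum`, which
-- needs one monomial for each stable set.
ΣP : ∀ n → (Subset n → Poly) → Poly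
ΣP zero    f = f []
ΣP (suc n) f = ΣP n (λ S → f (inside ∷ S)) +P ΣP n (λ S → f (outside ∷ S))

coeff-ΣP : ∀ n f k → coeff (ΣP n f) k ≡ Σ⊆ n (λ S → coeff (f S) k)
coeff-ΣP zero    f k = refl
coeff-ΣP (suc n) f k = trans (coeff-+P (ΣP n _) (ΣP n _) k) (cong₂ _+_ (coeff-ΣP n _ k) (coeff-ΣP n _ k))

⟪⟫-ΣP : ∀ w n f → ⟪ w , ΣP n f ⟫ ≡ Σ⊆ n (λ S → ⟪ w , f S ⟫)
⟪⟫-ΣP w zero    f = refl
⟪⟫-ΣP w (suc n) f = trans (⟪⟫-+P w (ΣP n _) (ΣP n _)) (cong₂ _+_ (⟪⟫-ΣP w n _) (⟪⟫-ΣP w n _))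

monomial : ℕ → Poly
monomial zero    = 1ℤ ∷ []
monomial (suc k) = 0ℤ ∷ monomial k

coeff-monomial : ∀ j k → coeff (monomial j) k ≡ δ k j
coeff-monomial zero    zero    = refl
coeff-monomial zero    (suc k) = refl
coeff-monomial (suc j) zero    = refl
coeff-monomial (suc j) (suc k) = coeff-monomial j k

⟪⟫-monomial : ∀ w j → ⟪ w , monomial j ⟫ ≡ w j
⟪⟫-monomial w zero    = trans (ℤₚ.+-identityʳ _) (ℤₚ.*-identityˡ _)
⟪⟫-monomial w (suc j) = trans (ℤₚ.+-identityˡ _) (⟪⟫-monomial (w ∘ suc) j)

stableCount-weightSum : ∀ G k → + stableCount G k ≡ weightSum (δ k) G
stableCount-weightSum G k =
  trans (length-filter-allSubsets (size G) (λ S → stable? G S ×-dec (∣ S ∣ ℕₚ.≟ k)))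
        (Σ⊆-cong (size G) λ S → if-∧ (does (stable? G S)) _)
  where
  if-∧ : ∀ a b → (if a ∧ b then 1ℤ else 0ℤ) ≡ (if a then (if b then 1ℤ else 0ℤ) else 0ℤ)
  if-∧ true  b = refl
  if-∧ false b = refl

if-zero : ∀ {P : Set} (P? : Dec P) {x} → (P → x ≡ 0ℤ) → (if does P? then x else 0ℤ) ≡ 0ℤ
if-zero (yes p) x≡0 = x≡0 p
if-zero (no  _) _   = refl

stableCount-large : ∀ G k → size G < k → stableCount G k ≡ 0
stableCount-large G k n<k = ℤₚ.+-injective (trans (stableCount-weightSum G k)
  (Σ⊆-zero (size G) λ S → if-zero (stable? G S) λ _ → δ≡0 S))
  where
  δ≡0 : ∀ S → δ k ∣ S ∣ ≡ 0ℤ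
  δ≡0 S = cong (if_then 1ℤ else 0ℤ)
    (dec-false (∣ S ∣ ℕ.≟ k) (ℕₚ.<⇒≢ (ℕₚ.≤-<-trans (∣p∣≤n S) n<k)))

coeff-map-applyUpTo-< : ∀ (f : ℕ → ℤ) g {N k} → k < N → coeff (map f (applyUpTo g N)) k ≡ f (g k)
coeff-map-applyUpTo-< f g {suc N} {zero}  _         = refl
coeff-map-applyUpTo-< f g {suc N} {suc k} (s≤s k<N) = coeff-map-applyUpTo-< f (g ∘ suc) k<N

coeff-map-applyUpTo-≥ : ∀ (f : ℕ → ℤ) g {N k} → N ≤ k → coeff (map f (applyUpTo g N)) k ≡ 0ℤ
coeff-map-applyUpTo-≥ f g {zero}              _         = refl
coeff-map-applyUpTo-≥ f g {suc N} {suc k} (s≤s N≤k) = coeff-map-applyUpTo-≥ f (g ∘ suc) N≤k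

-- Frees coefficient computations from the cut-off degree, both for `indepPoly` and for
-- `spiderFactor`.
coeff-map-upTo : ∀ (f : ℕ → ℤ) {N} → (∀ k → N ≤ k → f k ≡ 0ℤ) → ∀ k → coeff (map f (upTo N)) k ≡ f k
coeff-map-upTo f {N} f≡0 k with k ℕ.<? N
... | yes k<N = coeff-map-applyUpTo-< f id k<N
... | no  k≮N = trans (coeff-map-applyUpTo-≥ f id (ℕₚ.≮⇒≥ k≮N)) (sym (f≡0 k (ℕₚ.≮⇒≥ k≮N)))

coeff-indepPoly : ∀ G k → coeff (indepPoly G) k ≡ + stableCount G k
coeff-indepPoly G = coeff-map-upTo _ {suc (size G)} λ k n<k → cong +_ (stableCount-large G k n<k)

⟪⟫-indepPoly : ∀ w G → ⟪ w , indepPoly G ⟫ ≡ weightSum w G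
⟪⟫-indepPoly w G = begin
  ⟪ w , indepPoly G ⟫                            ≡⟨ ⟪⟫-cong w {indepPoly G} {ΣP (size G) term} indepPoly≈ΣP ⟩
  ⟪ w , ΣP (size G) term ⟫                       ≡⟨ ⟪⟫-ΣP w (size G) term ⟩
  Σ⊆ (size G) (λ S → ⟪ w , term S ⟫)             ≡⟨ Σ⊆-cong (size G) (λ S → ⟪⟫-if (does (stable? G S)) ∣ S ∣) ⟩
  weightSum w G                                  ∎
  where
  open ≡-Reasoning
  term : Subset (size G) → Poly
  term S = if does (stable? G S) then monomial ∣ S ∣ else []
  ⟪⟫-if : ∀ b j → ⟪ w , if b then monomial j else [] ⟫ ≡ (if b then w j else 0ℤ)
  ⟪⟫-if true  j = ⟪⟫-monomial w j
  ⟪⟫-if false j = refl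
  coeff-if : ∀ b j k → coeff (if b then monomial j else []) k ≡ (if b then δ k j else 0ℤ)
  coeff-if true  j k = coeff-monomial j k
  coeff-if false j k = refl
  indepPoly≈ΣP : indepPoly G ≈P ΣP (size G) term
  indepPoly≈ΣP k = begin
    coeff (indepPoly G) k                   ≡⟨ coeff-indepPoly G k ⟩
    + stableCount G k                       ≡⟨ stableCount-weightSum G k ⟩
    weightSum (δ k) G                       ≡⟨ Σ⊆-cong (size G) (λ S → coeff-if (does (stable? G S)) ∣ S ∣ k) ⟨
    Σ⊆ (size G) (λ S → coeff (term S) k)    ≡⟨ coeff-ΣP (size G) term k ⟨
    coeff (ΣP (size G) term) k              ∎

-- Coronas

Disjoint : ∀ {n} → Subset n → Subset n → Set
Disjoint A B = ∀ i → i ∈ A → i ∉ B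

disjoint? : ∀ {n} (A B : Subset n) → Dec (Disjoint A B)
disjoint? A B = all? λ i → (i ∈? A) →-dec ¬? (i ∈? B)

disjoint-in-in : ∀ {n} {A B : Subset n} → ¬ Disjoint (inside ∷ A) (inside ∷ B)
disjoint-in-in A#B = A#B zero here here

disjoint-in-out : ∀ {n} {A B : Subset n} → Disjoint (inside ∷ A) (outside ∷ B) ⇔ Disjoint A B
disjoint-in-out = mk⇔ (λ A#B i i∈A i∈B → A#B (suc i) (there i∈A) (there i∈B))
                      (λ { A#B (suc i) (there i∈A) (there i∈B) → A#B i i∈A i∈B })

disjoint-out : ∀ {n} {A B : Subset n} s → Disjoint (outside ∷ A) (s ∷ B) ⇔ Disjoint A B
disjoint-out s = mk⇔ (λ A#B i i∈A i∈B → A#B (suc i) (there i∈A) (there i∈B))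
                     (λ { A#B (suc i) (there i∈A) (there i∈B) → A#B i i∈A i∈B })

-- The sets B are the subsets of the complement of A. Each element outside A may or may not join B
-- and so contributes a factor 1+x; an element of A contributes 1.
Σ⊆-disjoint : ∀ {n} (A : Subset n) u →
  Σ⊆ n (λ B → if does (disjoint? A B) then u ∣ B ∣ else 0ℤ) ≡ steps 1ℤ ∣ ∁ A ∣ u 0
Σ⊆-disjoint [] u = refl
Σ⊆-disjoint {suc n} (inside ∷ A) u = begin
  _
    ≡⟨ cong₂ _+_
         (Σ⊆-zero n λ B → cong (if_then u (suc ∣ B ∣) else 0ℤ) (dec-false (disjoint? (inside ∷ A) (inside ∷ B)) disjoint-in-in))
         (Σ⊆-cong n λ B → cong (if_then u ∣ B ∣ else 0ℤ) (does-⇔ disjoint-in-out (disjoint? (inside ∷ A) (outside ∷ B)) (disjoint? A B))) ⟩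
  0ℤ + Σ⊆ n (λ B → if does (disjoint? A B) then u ∣ B ∣ else 0ℤ)
    ≡⟨ trans (ℤₚ.+-identityˡ _) (Σ⊆-disjoint A u) ⟩
  steps 1ℤ ∣ ∁ A ∣ u 0 ∎
  where open ≡-Reasoning
Σ⊆-disjoint {suc n} (outside ∷ A) u = begin
  _
    ≡⟨ cong₂ _+_
         (Σ⊆-cong n λ B → cong (if_then u (suc ∣ B ∣) else 0ℤ) (does-⇔ (disjoint-out inside) (disjoint? (outside ∷ A) (inside ∷ B)) (disjoint? A B)))
         (Σ⊆-cong n λ B → cong (if_then u ∣ B ∣ else 0ℤ) (does-⇔ (disjoint-out outside) (disjoint? (outside ∷ A) (outside ∷ B)) (disjoint? A B))) ⟩
  Σ⊆ n (λ B → if does (disjoint? A B) then u (suc ∣ B ∣) else 0ℤ) + Σ⊆ n (λ B → if does (disjoint? A B) then u ∣ B ∣ else 0ℤ)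
    ≡⟨ cong₂ _+_ (Σ⊆-disjoint A (u ∘ suc)) (Σ⊆-disjoint A u) ⟩
  steps 1ℤ co (u ∘ suc) 0 + steps 1ℤ co u 0
    ≡⟨ steps-+ 1ℤ co (u ∘ suc) u 0 ⟨
  steps 1ℤ co (λ a → u (suc a) + u a) 0
    ≡⟨ steps-cong 1ℤ co (λ a → trans (ℤₚ.+-comm (u (suc a)) (u a)) (cong (_+_ (u a)) (sym (ℤₚ.*-identityˡ _)))) 0 ⟩
  steps 1ℤ co (step 1ℤ u) 0 ∎
  where
  open ≡-Reasoning
  co = ∣ ∁ A ∣

∣++∣ : ∀ {m n} (A : Subset m) (B : Subset n) → ∣ A Vec.++ B ∣ ≡ ∣ A ∣ ℕ.+ ∣ B ∣
∣++∣ []            B = refl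
∣++∣ (inside ∷ A)  B = cong suc (∣++∣ A B)
∣++∣ (outside ∷ A) B = ∣++∣ A B

∈-++ˡ⁺ : ∀ {m n i} {A : Subset m} (B : Subset n) → i ∈ A → (i ↑ˡ n) ∈ (A Vec.++ B)
∈-++ˡ⁺ B here        = here
∈-++ˡ⁺ B (there i∈A) = there (∈-++ˡ⁺ B i∈A)

∈-++ʳ⁺ : ∀ {m n i} (A : Subset m) {B : Subset n} → i ∈ B → (m ↑ʳ i) ∈ (A Vec.++ B)
∈-++ʳ⁺ []      i∈B = i∈B
∈-++ʳ⁺ (_ ∷ A) i∈B = there (∈-++ʳ⁺ A i∈B)

∈-++ˡ⁻ : ∀ {m n} {i : Fin m} (A : Subset m) (B : Subset n) → (i ↑ˡ n) ∈ (A Vec.++ B) → i ∈ A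
∈-++ˡ⁻ {i = zero}  (_ ∷ A) B here      = here
∈-++ˡ⁻ {i = suc i} (_ ∷ A) B (there p) = there (∈-++ˡ⁻ A B p)

∈-++ʳ⁻ : ∀ {m n} {i : Fin n} (A : Subset m) (B : Subset n) → (m ↑ʳ i) ∈ (A Vec.++ B) → i ∈ B
∈-++ʳ⁻ []      B p         = p
∈-++ʳ⁻ (_ ∷ A) B (there p) = ∈-++ʳ⁻ A B p

eqB-refl : ∀ {n} (i : Fin n) → eqB i i ≡ true
eqB-refl i with i ≟ᶠ i
... | yes _   = refl
... | no  i≢i = contradiction refl i≢i

eqB-≢ : ∀ {n} {i j : Fin n} → i ≢ j → eqB i j ≡ false
eqB-≢ {i = i} {j} i≢j with i ≟ᶠ j
... | yes i≡j = contradiction i≡j i≢j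
... | no  _   = refl

eqB-true : ∀ {n} {i j : Fin n} → eqB i j ≡ true → i ≡ j
eqB-true {i = i} {j} eq with i ≟ᶠ j
... | yes i≡j = i≡j

module _ (G : Graph) where
  private n = size G

  stable-corona⇔ : ∀ A B → Stable (G *) (A Vec.++ B) ⇔ (Stable G A × Disjoint A B)
  stable-corona⇔ A B = mk⇔ to from
    where
    to : Stable (G *) (A Vec.++ B) → Stable G A × Disjoint A B
    to stable = stableA , disjoint
      where
      stableA : Stable G A
      stableA i j i∈A j∈A = trans (sym (cong₂ (corAdj G) (splitAt-↑ˡ n i n) (splitAt-↑ˡ n j n)))
                                  (stable _ _ (∈-++ˡ⁺ B i∈A) (∈-++ˡ⁺ B j∈A))
      disjoint : Disjoint A B
      disjoint i i∈A i∈B = contradiction (begin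
        true                                          ≡⟨ eqB-refl i ⟨
        eqB i i                                       ≡⟨ cong₂ (corAdj G) (splitAt-↑ˡ n i n) (splitAt-↑ʳ n n i) ⟨
        adj (G *) (i ↑ˡ n) (n ↑ʳ i)                   ≡⟨ stable _ _ (∈-++ˡ⁺ B i∈A) (∈-++ʳ⁺ A i∈B) ⟩
        false                                         ∎) λ ()
        where open ≡-Reasoning
    from : Stable G A × Disjoint A B → Stable (G *) (A Vec.++ B)
    from (stableA , A#B) x y x∈ y∈ = go (splitAt n x) (splitAt n y)
        (subst (_∈ (A Vec.++ B)) (sym (join-splitAt n n x)) x∈)
        (subst (_∈ (A Vec.++ B)) (sym (join-splitAt n n y)) y∈)
      where
      ≢-of-∈ : ∀ {i j} → i ∈ A → j ∈ B → i ≢ j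
      ≢-of-∈ i∈A i∈B refl = A#B _ i∈A i∈B
      go : ∀ s t → join n n s ∈ (A Vec.++ B) → join n n t ∈ (A Vec.++ B) → corAdj G s t ≡ false
      go (inj₁ i) (inj₁ j) p q = stableA i j (∈-++ˡ⁻ A B p) (∈-++ˡ⁻ A B q)
      go (inj₁ i) (inj₂ j) p q = eqB-≢ (≢-of-∈ (∈-++ˡ⁻ A B p) (∈-++ʳ⁻ A B q))
      go (inj₂ i) (inj₁ j) p q = eqB-≢ (≢-of-∈ (∈-++ˡ⁻ A B q) (∈-++ʳ⁻ A B p) ∘ sym)
      go (inj₂ i) (inj₂ j) p q = refl

  -- The weight `w` applied to x^|A| (1+x)^(n-|A|).
  coronaTerm : (ℕ → ℤ) → Subset n → ℤ
  coronaTerm w A = steps 1ℤ ∣ ∁ A ∣ (λ b → w (∣ A ∣ ℕ.+ b)) 0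

  weightSum-corona : ∀ w → weightSum w (G *) ≡ Σ⊆ n (λ A → if does (stable? G A) then coronaTerm w A else 0ℤ)
  weightSum-corona w = trans (Σ⊆-++ n n _) (Σ⊆-cong n λ A → begin
    Σ⊆ n (λ B → if does (stable? (G *) (A Vec.++ B)) then w ∣ A Vec.++ B ∣ else 0ℤ)
      ≡⟨ Σ⊆-cong n (λ B → cong₂ (λ b j → if b then w j else 0ℤ)
           (does-⇔ (stable-corona⇔ A B) (stable? (G *) (A Vec.++ B)) (stable? G A ×-dec disjoint? A B)) (∣++∣ A B)) ⟩
    Σ⊆ n (λ B → if does (stable? G A) ∧ does (disjoint? A B) then w (∣ A ∣ ℕ.+ ∣ B ∣) else 0ℤ)
      ≡⟨ pull (does (stable? G A)) A ⟩
    (if does (stable? G A) then coronaTerm w A else 0ℤ) ∎)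
    where
    open ≡-Reasoning
    pull : ∀ b A → Σ⊆ n (λ B → if b ∧ does (disjoint? A B) then w (∣ A ∣ ℕ.+ ∣ B ∣) else 0ℤ)
                 ≡ (if b then coronaTerm w A else 0ℤ)
    pull true  A = Σ⊆-disjoint A (λ b → w (∣ A ∣ ℕ.+ b))
    pull false A = Σ⊆-zero n (λ _ → refl)

-- Stars

∣∁⊥∣≡n : ∀ n → ∣ ∁ (⊥ {n}) ∣ ≡ n
∣∁⊥∣≡n n = trans (∣∁p∣≡n∸∣p∣ (⊥ {n})) (cong (n ∸_) (∣⊥∣≡0 n))

-- Dually, Σ_A x^|A| (1+x)^(m-|A|) = (1+2x)^m: each element contributes x inside A and 1+x outside.
Σ⊆-steps : ∀ m w → Σ⊆ m (λ A → steps 1ℤ ∣ ∁ A ∣ (λ b → w (∣ A ∣ ℕ.+ b)) 0) ≡ steps (+ 2) m w 0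
Σ⊆-steps zero    w = refl
Σ⊆-steps (suc m) w = begin
  _
    ≡⟨ cong₂ _+_ (Σ⊆-steps m (w ∘ suc))
         (trans (Σ⊆-cong m (λ A → steps-cong 1ℤ ∣ ∁ A ∣ (λ b → cong (λ j → w (∣ A ∣ ℕ.+ b) + 1ℤ · w j) (ℕₚ.+-suc ∣ A ∣ b)) 0))
                (Σ⊆-steps m (step 1ℤ w))) ⟩
  steps (+ 2) m (w ∘ suc) 0 + steps (+ 2) m (step 1ℤ w) 0
    ≡⟨ steps-+ (+ 2) m (w ∘ suc) (step 1ℤ w) 0 ⟨
  steps (+ 2) m (λ a → w (suc a) + step 1ℤ w a) 0
    ≡⟨ steps-cong (+ 2) m (λ a → lemma (w a) (w (suc a))) 0 ⟩
  steps (+ 2) (suc m) w 0 ∎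
  where
  open ≡-Reasoning
  lemma : ∀ x y → y + (x + + 1 · y) ≡ x + + 2 · y
  lemma = solve-∀

-- A stable set of the star with the centre is the centre alone, which gives x(1+x)^m. Without it
-- every set of leaves is stable, and the omitted centre supplies one more factor 1+x.
weightSum-star : ∀ m w → weightSum w ((K1, m) *) ≡ steps 1ℤ m (w ∘ suc) 0 + steps (+ 2) m (step 1ℤ w) 0
weightSum-star m w = trans (weightSum-corona (K1, m) w) (cong₂ _+_ with-centre without-centre)
  where
  open ≡-Reasoning
  centre-stable : ∀ A → Stable (K1, m) (inside ∷ A) → A ≡ ⊥
  centre-stable A stable = Empty-unique λ (i , i∈A) → contradiction (stable zero (suc i) here (there i∈A)) λ ()
  stable-centre : Stable (K1, m) (inside ∷ ⊥)
  stable-centre zero    zero    _         _         = refl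
  stable-centre zero    (suc j) _         (there p) = contradiction p ∉⊥
  stable-centre (suc i) j       (there p) _         = contradiction p ∉⊥
  stable-leaves : ∀ A → Stable (K1, m) (outside ∷ A)
  stable-leaves A (suc i) (suc j) _ _ = refl
  with-centre : Σ⊆ m (λ A → if does (stable? (K1, m) (inside ∷ A)) then coronaTerm (K1, m) w (inside ∷ A) else 0ℤ)
                ≡ steps 1ℤ m (w ∘ suc) 0
  with-centre = begin
    _
      ≡⟨ Σ⊆-single m ⊥ (λ A A≢⊥ → cong (if_then coronaTerm (K1, m) w (inside ∷ A) else 0ℤ)
           (dec-false (stable? (K1, m) (inside ∷ A)) (A≢⊥ ∘ centre-stable A))) ⟩
    (if does (stable? (K1, m) (inside ∷ ⊥)) then coronaTerm (K1, m) w (inside ∷ ⊥) else 0ℤ)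
      ≡⟨ cong (if_then coronaTerm (K1, m) w (inside ∷ ⊥) else 0ℤ) (dec-true (stable? (K1, m) (inside ∷ ⊥)) stable-centre) ⟩
    steps 1ℤ ∣ ∁ (⊥ {m}) ∣ (λ b → w (suc (∣ ⊥ {m} ∣ ℕ.+ b))) 0
      ≡⟨ cong₂ (λ k j → steps 1ℤ k (λ b → w (suc (j ℕ.+ b))) 0) (∣∁⊥∣≡n m) (∣⊥∣≡0 m) ⟩
    steps 1ℤ m (w ∘ suc) 0 ∎
  without-centre : Σ⊆ m (λ A → if does (stable? (K1, m) (outside ∷ A)) then coronaTerm (K1, m) w (outside ∷ A) else 0ℤ)
                   ≡ steps (+ 2) m (step 1ℤ w) 0
  without-centre = begin
    _
      ≡⟨ Σ⊆-cong m (λ A → trans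
           (cong (if_then coronaTerm (K1, m) w (outside ∷ A) else 0ℤ) (dec-true (stable? (K1, m) (outside ∷ A)) (stable-leaves A)))
           (steps-cong 1ℤ ∣ ∁ A ∣ (λ b → cong (λ j → w (∣ A ∣ ℕ.+ b) + 1ℤ · w j) (ℕₚ.+-suc ∣ A ∣ b)) 0)) ⟩
    Σ⊆ m (λ A → steps 1ℤ ∣ ∁ A ∣ (λ b → step 1ℤ w (∣ A ∣ ℕ.+ b)) 0)
      ≡⟨ Σ⊆-steps m (step 1ℤ w) ⟩
    steps (+ 2) m (step 1ℤ w) 0 ∎

spiderCoeff : ℕ → ℕ → ℕ
spiderCoeff n zero    = 1
spiderCoeff n (suc k) = (n C suc k) ℕ.* 2 ℕ.^ suc k ℕ.+ ((n ∸ 1) C k)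

-- The index is positive because truncated subtraction would give `spiderCoeff 0 1` the value 1,
-- beyond the end of the list `spiderFactor 0`.
coeff-spiderFactor : ∀ n k → coeff (spiderFactor (suc n)) k ≡ + spiderCoeff (suc n) k
coeff-spiderFactor n zero    = refl
coeff-spiderFactor n (suc k) = coeff-map-upTo (λ j → + spiderCoeff (suc n) (suc j)) {suc n} vanish k
  where
  vanish : ∀ j → suc n ≤ j → + spiderCoeff (suc n) (suc j) ≡ 0ℤ
  vanish j n<j = cong +_ (cong₂ (λ a b → a ℕ.* 2 ℕ.^ suc j ℕ.+ b) (k>n⇒nCk≡0 (s≤s n<j)) (k>n⇒nCk≡0 n<j))

-- Dually, I(Sₙ) = x(1+x)ⁿ + (1+x)(1+2x)ⁿ.
indepPoly-spider : ∀ n → indepPoly ((K1, suc n) *) ≈P (onePlusX *P spiderFactor (suc n))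
indepPoly-spider n k = trans (trans (coeff-indepPoly ((K1, suc n) *) k)
  (trans (stableCount-weightSum ((K1, suc n) *) k) (weightSum-star (suc n) (δ k)))) (go k)
  where
  open ≡-Reasoning
  go : ∀ k → steps 1ℤ (suc n) (δ k ∘ suc) 0 + steps (+ 2) (suc n) (step 1ℤ (δ k)) 0
           ≡ coeff (onePlusX *P spiderFactor (suc n)) k
  go zero = begin
    _
      ≡⟨ cong₂ _+_ (steps-zero 1ℤ (suc n) (λ _ → refl) 0)
           (trans (steps-cong (+ 2) (suc n) (λ a → ℤₚ.+-identityʳ (δ 0 a)) 0) (steps-δ 2 (suc n) 0)) ⟩
    1ℤ
      ≡⟨ coeff-onePlusX-zero (spiderFactor (suc n)) ⟨
    coeff (onePlusX *P spiderFactor (suc n)) 0 ∎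
  go (suc k) = begin
    _
      ≡⟨ cong₂ _+_ (trans (steps-δ 1 (suc n) k) (cong +_ (trans (cong ((suc n C k) ℕ.*_) (ℕₚ.^-zeroˡ k)) (ℕₚ.*-identityʳ (suc n C k)))))
           (trans (steps-cong (+ 2) (suc n) (λ a → cong (_+_ (δ (suc k) a)) (ℤₚ.*-identityˡ (δ k a))) 0)
             (trans (steps-+ (+ 2) (suc n) (δ (suc k)) (δ k) 0)
               (cong₂ _+_ (steps-δ 2 (suc n) (suc k)) (steps-δ 2 (suc n) k)))) ⟩
    + ((suc n C k) ℕ.+ ((suc n C suc k) ℕ.* 2 ℕ.^ suc k ℕ.+ (suc n C k) ℕ.* 2 ℕ.^ k))
      ≡⟨ cong +_ (arith k) ⟩
    + spiderCoeff (suc n) (suc k) + + spiderCoeff (suc n) k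
      ≡⟨ cong₂ _+_ (coeff-spiderFactor n (suc k)) (coeff-spiderFactor n k) ⟨
    coeff (spiderFactor (suc n)) (suc k) + coeff (spiderFactor (suc n)) k
      ≡⟨ coeff-onePlusX-suc (spiderFactor (suc n)) k ⟨
    coeff (onePlusX *P spiderFactor (suc n)) (suc k) ∎
    where
    arith : ∀ k → (suc n C k) ℕ.+ ((suc n C suc k) ℕ.* 2 ℕ.^ suc k ℕ.+ (suc n C k) ℕ.* 2 ℕ.^ k)
                ≡ spiderCoeff (suc n) (suc k) ℕ.+ spiderCoeff (suc n) k
    arith zero    = ℕₚ.+-comm 1 _
    -- Pascal's rule splits the coefficient coming from x(1+x)^(n+1) into the correction terms of
    -- two consecutive coefficients of the factor.
    arith (suc k) = trans
      (cong (ℕ._+ (X ℕ.+ Y)) (trans (sym (nCk+nC[k+1]≡[n+1]C[k+1] n k)) (ℕₚ.+-comm (n C k) (n C suc k))))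
      (shuffle (n C suc k) (n C k) X Y)
      where
      X = (suc n C suc (suc k)) ℕ.* 2 ℕ.^ suc (suc k)
      Y = (suc n C suc k) ℕ.* 2 ℕ.^ suc k
      shuffle : ∀ a b x y → (a ℕ.+ b) ℕ.+ (x ℕ.+ y) ≡ (x ℕ.+ a) ℕ.+ (y ℕ.+ b)
      shuffle = solveℕ-∀

-- Isomorphisms

≅-sym : ∀ {G H} → G ≅ H → H ≅ G
≅-sym {G} {H} (f , f-adj) = ↔-sym f , λ i j →
  trans (sym (f-adj _ _)) (cong₂ (adj H) (Inverse.strictlyInverseˡ f i) (Inverse.strictlyInverseˡ f j))

≅-trans : ∀ {G H K} → G ≅ H → H ≅ K → G ≅ K
≅-trans (f , f-adj) (g , g-adj) = ↔-trans f g , λ i j → trans (g-adj _ _) (f-adj i j)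

bijective⇒↔ : ∀ {A B : Set} (f : A → B) → (∀ x y → f x ≡ f y → x ≡ y) → (∀ y → ∃ λ x → f x ≡ y) → A ↔ B
bijective⇒↔ f inj surj = mk↔ₛ′ f (proj₁ ∘ surj) (proj₂ ∘ surj) λ x → inj _ _ (proj₂ (surj (f x)))

eqB-cong : ∀ {m n} (f : Fin m ↔ Fin n) i j → eqB (Inverse.to f i) (Inverse.to f j) ≡ eqB i j
eqB-cong f i j with i ≟ᶠ j
... | yes refl = eqB-refl (Inverse.to f i)
... | no  i≢j  = eqB-≢ λ eq → i≢j (trans (sym (Inverse.strictlyInverseʳ f i))
                                      (trans (cong (Inverse.from f) eq) (Inverse.strictlyInverseʳ f j)))

corona-cong : ∀ {G H} → G ≅ H → (G *) ≅ (H *)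
corona-cong {G} {H} (f , f-adj) = mk↔ₛ′ (lift to) (lift from)
  (lift-inverse to from strictlyInverseˡ) (lift-inverse from to strictlyInverseʳ) , lift-adj
  where
  open Inverse f using (to; from; strictlyInverseˡ; strictlyInverseʳ)
  lift : ∀ {m n} → (Fin m → Fin n) → Fin (m ℕ.+ m) → Fin (n ℕ.+ n)
  lift {m} {n} h x = join n n (Sum.map h h (splitAt m x))
  lift-inverse : ∀ {m n} (h : Fin m → Fin n) (k : Fin n → Fin m) → (∀ i → h (k i) ≡ i) → ∀ x → lift h (lift k x) ≡ x
  lift-inverse {m} {n} h k hk x = begin
    join n n (Sum.map h h (splitAt m (join m m (Sum.map k k (splitAt n x)))))
      ≡⟨ cong (join n n ∘ Sum.map h h) (splitAt-join m m (Sum.map k k (splitAt n x))) ⟩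
    join n n (Sum.map h h (Sum.map k k (splitAt n x)))
      ≡⟨ cong (join n n) (cancel (splitAt n x)) ⟩
    join n n (splitAt n x)
      ≡⟨ join-splitAt n n x ⟩
    x ∎
    where
    open ≡-Reasoning
    cancel : ∀ s → Sum.map h h (Sum.map k k s) ≡ s
    cancel (inj₁ i) = cong inj₁ (hk i)
    cancel (inj₂ i) = cong inj₂ (hk i)
  lift-adj : ∀ x y → adj (H *) (lift to x) (lift to y) ≡ adj (G *) x y
  lift-adj x y = trans (cong₂ (corAdj H) (splitAt-join (size H) (size H) (Sum.map to to (splitAt (size G) x)))
                                         (splitAt-join (size H) (size H) (Sum.map to to (splitAt (size G) y))))
                       (go (splitAt (size G) x) (splitAt (size G) y))
    where
    go : ∀ s t → corAdj H (Sum.map to to s) (Sum.map to to t) ≡ corAdj G s t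
    go (inj₁ i) (inj₁ j) = f-adj i j
    go (inj₁ i) (inj₂ j) = eqB-cong f i j
    go (inj₂ i) (inj₁ j) = eqB-cong f i j
    go (inj₂ i) (inj₂ j) = refl

-- Isomorphism invariance of the independence polynomial

module ℕΣ = Algebra.Properties.CommutativeMonoid.Sum ℕₚ.+-0-commutativeMonoid

∣tabulate∣ : ∀ {n} (f : Fin n → Bool) → ∣ Vec.tabulate f ∣ ≡ ℕΣ.sum (λ i → if f i then 1 else 0)
∣tabulate∣ {zero}  f = refl
∣tabulate∣ {suc n} f with f zero
... | true  = cong suc (∣tabulate∣ (f ∘ suc))
... | false = ∣tabulate∣ (f ∘ suc)

image : ∀ {m n} → Fin m ↔ Fin n → Subset m → Subset n
image π S = Vec.tabulate (Vec.lookup S ∘ Inverse.from π)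

-- Cardinality is a sum of indicators, and such a sum can be reindexed along π.
∣image∣ : ∀ {m n} (π : Fin m ↔ Fin n) S → ∣ image π S ∣ ≡ ∣ S ∣
∣image∣ π S = begin
  ∣ image π S ∣                                                       ≡⟨ ∣tabulate∣ (Vec.lookup S ∘ Inverse.from π) ⟩
  ℕΣ.sum (λ j → if Vec.lookup S (Inverse.from π j) then 1 else 0)     ≡⟨ ℕΣ.sum-permute (λ i → if Vec.lookup S i then 1 else 0) (↔-sym π) ⟨
  ℕΣ.sum (λ i → if Vec.lookup S i then 1 else 0)                      ≡⟨ ∣tabulate∣ (Vec.lookup S) ⟨
  ∣ Vec.tabulate (Vec.lookup S) ∣                                     ≡⟨ cong ∣_∣ (tabulate∘lookup S) ⟩
  ∣ S ∣                                                               ∎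
  where open ≡-Reasoning

∈-image⁻ : ∀ {m n} (π : Fin m ↔ Fin n) {S j} → j ∈ image π S → Inverse.from π j ∈ S
∈-image⁻ π {S} {j} j∈ = lookup⇒[]= _ S (trans (sym (lookup∘tabulate _ j)) ([]=⇒lookup j∈))

∈-image⁺ : ∀ {m n} (π : Fin m ↔ Fin n) {S i} → i ∈ S → Inverse.to π i ∈ image π S
∈-image⁺ π {S} {i} i∈ = lookup⇒[]= _ (image π S)
  (trans (lookup∘tabulate _ (Inverse.to π i)) (trans (cong (Vec.lookup S) (Inverse.strictlyInverseʳ π i)) ([]=⇒lookup i∈)))

image-injective : ∀ {m n} (π : Fin m ↔ Fin n) {S T} → image π S ≡ image π T → S ≡ T
image-injective π {S} {T} eq = ⊆-antisym (half eq) (half (sym eq))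
  where
  half : ∀ {S T} → image π S ≡ image π T → S ⊆ T
  half {S} {T} eq {i} i∈S = subst (_∈ T) (Inverse.strictlyInverseʳ π i)
    (∈-image⁻ π (subst (Inverse.to π i ∈_) eq (∈-image⁺ π i∈S)))

-- The pigeonhole principle, used for counts of stable sets, for degrees and for the length of
-- paths.
unique-⊆⇒length≤ : ∀ {A : Set} {xs ys : List A} → Unique xs → (∀ {x} → x ∈ˡ xs → x ∈ˡ ys) → length xs ≤ length ys
unique-⊆⇒length≤ {xs = []}     _               _     = z≤n
unique-⊆⇒length≤ {xs = x ∷ xs} {ys} (x∉xs ∷ unique) xs⊆ys with as , bs , refl ← ∈-∃++ (xs⊆ys (here refl)) = begin
  suc (length xs)                    ≤⟨ s≤s (unique-⊆⇒length≤ unique xs⊆as++bs) ⟩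
  suc (length (as List.++ bs))       ≡⟨ cong suc (length-++ as) ⟩
  suc (length as ℕ.+ length bs)      ≡⟨ ℕₚ.+-suc (length as) (length bs) ⟨
  length as ℕ.+ length (x ∷ bs)      ≡⟨ length-++ as ⟨
  length (as List.++ x ∷ bs)         ∎
  where
  open ℕₚ.≤-Reasoning
  xs⊆as++bs : ∀ {y} → y ∈ˡ xs → y ∈ˡ (as List.++ bs)
  xs⊆as++bs y∈xs with ∈-++⁻ as (xs⊆ys (there y∈xs))
  ... | inj₁ y∈as         = ∈-++⁺ˡ y∈as
  ... | inj₂ (here refl)  = contradiction refl (All.lookup x∉xs y∈xs)
  ... | inj₂ (there y∈bs) = ∈-++⁺ʳ as y∈bs

∈-allSubsets : ∀ {n} (S : Subset n) → S ∈ˡ allSubsets n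
∈-allSubsets []                    = here refl
∈-allSubsets {suc n} (inside ∷ S)  = ∈-++⁺ˡ (∈-map⁺ (inside ∷_) (∈-allSubsets S))
∈-allSubsets {suc n} (outside ∷ S) = ∈-++⁺ʳ (map (inside ∷_) (allSubsets n)) (∈-map⁺ (outside ∷_) (∈-allSubsets S))

allSubsets-unique : ∀ n → Unique (allSubsets n)
allSubsets-unique zero    = All.[] ∷ []
allSubsets-unique (suc n) = Unique.++⁺
  (Unique.map⁺ ∷-injectiveʳ (allSubsets-unique n)) (Unique.map⁺ ∷-injectiveʳ (allSubsets-unique n))
  λ (S∈ins , S∈outs) → case-disjoint (∈-map⁻ (inside ∷_) S∈ins) (∈-map⁻ (outside ∷_) S∈outs)
  where
  case-disjoint : ∀ {S} → (∃ λ T → T ∈ˡ allSubsets n × S ≡ inside ∷ T) →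
                  (∃ λ T → T ∈ˡ allSubsets n × S ≡ outside ∷ T) → _
  case-disjoint (_ , _ , refl) (_ , _ , ())

-- Images inject the stable k-sets of `G` into those of `H`; the inverse isomorphism supplies the
-- other inequality.
stableCount-≤ : ∀ {G H} → G ≅ H → ∀ k → stableCount G k ≤ stableCount H k
stableCount-≤ {G} {H} (f , f-adj) k = subst (_≤ stableCount H k) (length-map (image f) stables)
  (unique-⊆⇒length≤ (Unique.map⁺ (image-injective f)
    (Unique.filter⁺ (λ S → stable? G S ×-dec (∣ S ∣ ℕₚ.≟ k)) (allSubsets-unique (size G)))) ⊆-stable)
  where
  stables : List (Subset (size G))
  stables = filter (λ S → stable? G S ×-dec (∣ S ∣ ℕₚ.≟ k)) (allSubsets (size G))
  ⊆-stable : ∀ {T} → T ∈ˡ map (image f) stables →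
             T ∈ˡ filter (λ S → stable? H S ×-dec (∣ S ∣ ℕₚ.≟ k)) (allSubsets (size H))
  ⊆-stable T∈ with S , S∈ , refl ← ∈-map⁻ (image f) T∈
                 with _ , stable , ∣S∣≡k ← ∈-filter⁻ (λ S → stable? G S ×-dec (∣ S ∣ ℕₚ.≟ k)) {xs = allSubsets (size G)} S∈ =
    ∈-filter⁺ (λ S → stable? H S ×-dec (∣ S ∣ ℕₚ.≟ k)) (∈-allSubsets (image f S))
      ( (λ i j i∈ j∈ → trans (sym (proj₂ (≅-sym {G} {H} (f , f-adj)) i j)) (stable _ _ (∈-image⁻ f i∈) (∈-image⁻ f j∈)))
      , trans (∣image∣ f S) ∣S∣≡k)

indepPoly-cong : ∀ {G H} → G ≅ H → indepPoly G ≈P indepPoly H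
indepPoly-cong {G} {H} G≅H k = trans (coeff-indepPoly G k)
  (trans (cong +_ (ℕₚ.≤-antisym (stableCount-≤ {G} {H} G≅H k) (stableCount-≤ {H} {G} (≅-sym {G} {H} G≅H) k)))
         (sym (coeff-indepPoly H k)))

-- Stars and the root −1

step-shift : ∀ w j a → step 1ℤ (λ b → w (j ℕ.+ b)) a ≡ step 1ℤ w (j ℕ.+ a)
step-shift w j a = cong (λ i → w (j ℕ.+ a) + 1ℤ · w i) (ℕₚ.+-suc j a)

sgn≢0 : ∀ k → sgn k ≢ 0ℤ
sgn≢0 zero    ()
sgn≢0 (suc k) eq = sgn≢0 k (ℤₚ.neg-injective eq)

-- The factor 1+2x takes the value -1 at -1.
steps-sgn : ∀ m → steps (+ 2) m sgn 0 ≡ sgn m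
steps-sgn zero    = refl
steps-sgn (suc m) = begin
  steps (+ 2) m (step (+ 2) sgn) 0         ≡⟨ steps-cong (+ 2) m (λ a → lemma (sgn a)) 0 ⟩
  steps (+ 2) m (λ a → -[1+ 0 ] · sgn a) 0 ≡⟨ steps-* (+ 2) m -[1+ 0 ] sgn 0 ⟩
  -[1+ 0 ] · steps (+ 2) m sgn 0           ≡⟨ ℤₚ.-1*i≡-i _ ⟩
  - steps (+ 2) m sgn 0                    ≡⟨ cong -_ (steps-sgn m) ⟩
  sgn (suc m)                              ∎
  where
  open ≡-Reasoning
  lemma : ∀ x → x + + 2 · (- x) ≡ -[1+ 0 ] · x
  lemma = solve-∀

-- Both summands of x(1+x)^(m+1) + (1+x)(1+2x)^(m+1) vanish at -1. For positive m the first has a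
-- multiple root there, so the derivative comes from the second alone and is ±1.
simpleRoot-star : ∀ m → RootMultiplicity (indepPoly ((K1, suc m) *)) -[1+ 0 ] 1
simpleRoot-star m = simpleRoot⇐ (indepPoly ((K1, suc m) *))
  (trans (⟪⟫-indepPoly sgn ((K1, suc m) *)) (trans (weightSum-star (suc m) sgn)
    (cong₂ _+_ (steps-zero 1ℤ m (λ a → step-sgn (suc a)) 0) (steps-zero (+ 2) (suc m) step-sgn 0))))
  λ eq → nonzero m (trans (sym value) eq)
  where
  open ≡-Reasoning
  value : ⟪ index·sgn , indepPoly ((K1, suc m) *) ⟫ ≡ steps 1ℤ m (λ a → - sgn (suc a)) 0 + - sgn (suc m)
  value = begin
    ⟪ index·sgn , indepPoly ((K1, suc m) *) ⟫
      ≡⟨ trans (⟪⟫-indepPoly index·sgn ((K1, suc m) *)) (weightSum-star (suc m) index·sgn) ⟩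
    steps 1ℤ (suc m) (index·sgn ∘ suc) 0 + steps (+ 2) (suc m) (step 1ℤ index·sgn) 0
      ≡⟨ cong₂ _+_ (steps-cong 1ℤ m (λ a → step-index·sgn (suc a)) 0)
           (trans (steps-cong (+ 2) (suc m) (λ a → trans (step-index·sgn a) (sym (ℤₚ.-1*i≡-i (sgn a)))) 0)
             (trans (steps-* (+ 2) (suc m) -[1+ 0 ] sgn 0) (trans (ℤₚ.-1*i≡-i _) (cong -_ (steps-sgn (suc m)))))) ⟩
    steps 1ℤ m (λ a → - sgn (suc a)) 0 + - sgn (suc m) ∎
  nonzero : ∀ m → steps 1ℤ m (λ a → - sgn (suc a)) 0 + - sgn (suc m) ≢ 0ℤ
  -- For K_{1,1} both summands have a simple root; their contributions have the same sign and do not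
  -- cancel.
  nonzero zero    ()
  nonzero (suc m) eq = sgn≢0 (suc (suc (suc m))) (trans (sym (trans (cong (_+ - sgn (suc (suc m)))
    (steps-zero 1ℤ m (λ a → lemma (sgn a)) 0)) (ℤₚ.+-identityˡ _))) eq)
    where
    lemma : ∀ x → - - x + 1ℤ · (- - - x) ≡ + 0
    lemma = solve-∀

walk-invariant : ∀ {G} (P : Fin (size G) → Set) → (∀ {x y} → P x → Adj G x y → P y) → ∀ {x y} → Walk G x y → P x → P y
walk-invariant P closed nil        Px = Px
walk-invariant P closed (cons e w) Px = walk-invariant P closed w (closed Px e)

∣S∣≡0⇒S≡⊥ : ∀ {n} (S : Subset n) → ∣ S ∣ ≡ 0 → S ≡ ⊥
∣S∣≡0⇒S≡⊥ []            _  = refl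
∣S∣≡0⇒S≡⊥ (outside ∷ S) eq = cong (outside ∷_) (∣S∣≡0⇒S≡⊥ S eq)

∣S∣≡1⇒S≡⁅v⁆ : ∀ {n} (S : Subset n) → ∣ S ∣ ≡ 1 → ∃ λ v → S ≡ ⁅ v ⁆
∣S∣≡1⇒S≡⁅v⁆ (inside ∷ S)  eq = zero , cong (inside ∷_) (∣S∣≡0⇒S≡⊥ S (ℕₚ.suc-injective eq))
∣S∣≡1⇒S≡⁅v⁆ (outside ∷ S) eq with v , S≡⁅v⁆ ← ∣S∣≡1⇒S≡⁅v⁆ S eq = suc v , cong (outside ∷_) S≡⁅v⁆

-- A vertex cover of size one; equivalently, the complement of `v` is stable.
CoversEdges : (G : Graph) → Fin (size G) → Set
CoversEdges G v = ∀ i j → i ≢ v → j ≢ v → adj G i j ≡ false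

coversEdges? : ∀ G v → Dec (CoversEdges G v)
coversEdges? G v = all? λ i → all? λ j → ¬? (i ≟ᶠ v) →-dec (¬? (j ≟ᶠ v) →-dec (adj G i j ≟ᵇ false))

-- `punchIn v` numbers the leaves. The size equation is kept so that the number of leaves can be
-- identified later.
star-of-centre : ∀ G v → CoversEdges G v → (∀ i → i ≢ v → Adj G v i) → ∃ λ m → size G ≡ suc m × G ≅ (K1, m)
star-of-centre G@(record { size = suc m }) v covers spokes = m , refl , ≅-sym {K1, m} {G} (bijective⇒↔ to injective surjective , to-adj)
  where
  to : Fin (suc m) → Fin (suc m)
  to zero    = v
  to (suc i) = punchIn v i
  injective : ∀ i j → to i ≡ to j → i ≡ j
  injective zero    zero    _  = refl
  injective zero    (suc j) eq = contradiction (sym eq) (punchInᵢ≢i v j)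
  injective (suc i) zero    eq = contradiction eq (punchInᵢ≢i v i)
  injective (suc i) (suc j) eq = cong suc (punchIn-injective v i j eq)
  surjective : ∀ j → ∃ λ i → to i ≡ j
  surjective j with v ≟ᶠ j
  ... | yes v≡j = zero , v≡j
  ... | no  v≢j = suc (punchOut v≢j) , punchIn-punchOut v≢j
  to-adj : ∀ i j → adj G (to i) (to j) ≡ starAdj i j
  to-adj zero    zero    = adj-irrefl G v
  to-adj zero    (suc j) = spokes _ (punchInᵢ≢i v j)
  to-adj (suc i) zero    = trans (adj-sym G _ v) (spokes _ (punchInᵢ≢i v i))
  to-adj (suc i) (suc j) = covers _ _ (punchInᵢ≢i v i) (punchInᵢ≢i v j)

module _ (G : Graph) where
  private n = size G

  coronaTerm-sgn : ∀ A {m} → ∣ ∁ A ∣ ≡ suc m → coronaTerm G sgn A ≡ 0ℤ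
  coronaTerm-sgn A {m} eq = trans (cong (λ k → steps 1ℤ k (λ b → sgn (∣ A ∣ ℕ.+ b)) 0) eq)
    (steps-zero 1ℤ m (λ a → trans (step-shift sgn ∣ A ∣ a) (step-sgn (∣ A ∣ ℕ.+ a))) 0)

  -- With two factors 1+x left the term has a double root at -1: one `step 1ℤ` turns `index·sgn`
  -- into minus `sgn`, the next one kills it.
  coronaTerm-index·sgn : ∀ A {m} → ∣ ∁ A ∣ ≡ suc (suc m) → coronaTerm G index·sgn A ≡ 0ℤ
  coronaTerm-index·sgn A {m} eq = trans (cong (λ k → steps 1ℤ k (λ b → index·sgn (∣ A ∣ ℕ.+ b)) 0) eq)
    (trans (steps-cong 1ℤ (suc m) (λ a → trans (step-shift index·sgn ∣ A ∣ a) (trans (step-index·sgn (∣ A ∣ ℕ.+ a)) (sym (ℤₚ.-1*i≡-i _)))) 0)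
    (trans (steps-* 1ℤ (suc m) -[1+ 0 ] (λ a → sgn (∣ A ∣ ℕ.+ a)) 0)
           (cong (-[1+ 0 ] ·_) (steps-zero 1ℤ m (λ a → trans (step-shift sgn ∣ A ∣ a) (step-sgn (∣ A ∣ ℕ.+ a))) 0))))

  ∣∁A∣≡0⇒A≡⊤ : ∀ (A : Subset n) → ∣ ∁ A ∣ ≡ 0 → A ≡ ⊤
  ∣∁A∣≡0⇒A≡⊤ A eq = ∣p∣≡n⇒p≡⊤ (ℕₚ.≤-antisym (∣p∣≤n A) (ℕₚ.m∸n≡0⇒m≤n (trans (sym (∣∁p∣≡n∸∣p∣ A)) eq)))

  ∣∁⊤∣≡0 : ∣ ∁ (⊤ {n}) ∣ ≡ 0
  ∣∁⊤∣≡0 = trans (∣∁p∣≡n∸∣p∣ (⊤ {n})) (trans (cong (n ∸_) (∣⊤∣≡n n)) (ℕₚ.n∸n≡0 n))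

  -- Only A = ⊤ leaves no factor 1+x, so the value at -1 is that of x^n, which is ±1.
  edgeless⇒¬root : Stable G ⊤ → ⟪ sgn , indepPoly (G *) ⟫ ≢ 0ℤ
  edgeless⇒¬root stable eq = sgn≢0 (∣ ⊤ {n} ∣ ℕ.+ 0) (begin
    sgn (∣ ⊤ {n} ∣ ℕ.+ 0)
      ≡⟨ cong (λ k → steps 1ℤ k (λ b → sgn (∣ ⊤ {n} ∣ ℕ.+ b)) 0) ∣∁⊤∣≡0 ⟨
    coronaTerm G sgn ⊤
      ≡⟨ cong (if_then coronaTerm G sgn ⊤ else 0ℤ) (dec-true (stable? G ⊤) stable) ⟨
    (if does (stable? G ⊤) then coronaTerm G sgn ⊤ else 0ℤ)
      ≡⟨ Σ⊆-single n ⊤ others ⟨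
    Σ⊆ n (λ A → if does (stable? G A) then coronaTerm G sgn A else 0ℤ)
      ≡⟨ weightSum-corona G sgn ⟨
    weightSum sgn (G *)
      ≡⟨ ⟪⟫-indepPoly sgn (G *) ⟨
    ⟪ sgn , indepPoly (G *) ⟫
      ≡⟨ eq ⟩
    0ℤ ∎)
    where
    open ≡-Reasoning
    others : ∀ A → A ≢ ⊤ → (if does (stable? G A) then coronaTerm G sgn A else 0ℤ) ≡ 0ℤ
    others A A≢⊤ = if-zero (stable? G A) λ _ → go ∣ ∁ A ∣ refl
      where
      go : ∀ k → ∣ ∁ A ∣ ≡ k → coronaTerm G sgn A ≡ 0ℤ
      go zero    eq = contradiction (∣∁A∣≡0⇒A≡⊤ A eq) A≢⊤
      go (suc m) eq = coronaTerm-sgn A eq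

  -- Every stable set omits at least two vertices here, so each term has a double root at -1.
  uncovered⇒multipleRoot : ¬ Stable G ⊤ → (∀ v → ¬ CoversEdges G v) → ⟪ index·sgn , indepPoly (G *) ⟫ ≡ 0ℤ
  uncovered⇒multipleRoot ¬stable⊤ uncovered =
    trans (⟪⟫-indepPoly index·sgn (G *)) (trans (weightSum-corona G index·sgn) (Σ⊆-zero n vanish))
    where
    vanish : ∀ A → (if does (stable? G A) then coronaTerm G index·sgn A else 0ℤ) ≡ 0ℤ
    vanish A = if-zero (stable? G A) λ stable → go stable ∣ ∁ A ∣ refl
      where
      go : Stable G A → ∀ k → ∣ ∁ A ∣ ≡ k → coronaTerm G index·sgn A ≡ 0ℤ
      go stable zero          eq = contradiction (subst (Stable G) (∣∁A∣≡0⇒A≡⊤ A eq) stable) ¬stable⊤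
      go stable (suc zero)    eq with v , ∁A≡⁅v⁆ ← ∣S∣≡1⇒S≡⁅v⁆ (∁ A) eq =
        contradiction (λ i j i≢v j≢v → stable i j (∈A i≢v) (∈A j≢v)) (uncovered v)
        where
        ∈A : ∀ {i} → i ≢ v → i ∈ A
        ∈A i≢v = x∉∁p⇒x∈p λ i∈∁A → i≢v (x∈⁅y⁆⇒x≡y v (subst (_ ∈_) ∁A≡⁅v⁆ i∈∁A))
      go stable (suc (suc m)) eq = coronaTerm-index·sgn A eq

  -- The vertex i and its pendant form a set closed under adjacency, so no walk from i reaches v.
  isolated⇒disconnected : ∀ {i v} → i ≢ v → (∀ j → adj G i j ≡ false) → ¬ Connected (G *)
  isolated⇒disconnected {i} {v} i≢v isolated connected
    with walk-invariant {G *} (λ x → At (splitAt n x)) (λ {x} {y} → closed {splitAt n x} {splitAt n y})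
           (connected (i ↑ˡ n) (v ↑ˡ n)) (inj₁ (splitAt-↑ˡ n i n))
    where
    At : Fin n ⊎ Fin n → Set
    At s = s ≡ inj₁ i ⊎ s ≡ inj₂ i
    closed : ∀ {s t} → At s → corAdj G s t ≡ true → At t
    closed {t = inj₁ j} (inj₁ refl) e = contradiction (trans (sym e) (isolated j)) λ ()
    closed {t = inj₂ j} (inj₁ refl) e = inj₂ (cong inj₂ (sym (eqB-true e)))
    closed {t = inj₁ j} (inj₂ refl) e = inj₁ (cong inj₁ (sym (eqB-true e)))
    closed {t = inj₂ j} (inj₂ refl) ()
  ... | inj₁ eq with refl ← trans (sym (splitAt-↑ˡ n v n)) eq = i≢v refl
  ... | inj₂ eq with () ← trans (sym (splitAt-↑ˡ n v n)) eq

  -- As `v` meets every edge, a vertex not joined to `v` is isolated in `G`, which connectedness of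
  -- `G *` excludes.
  covered⇒star : Connected (G *) → ∀ v → CoversEdges G v → ∃ λ m → size G ≡ suc m × G ≅ (K1, m)
  covered⇒star connected v covers = star-of-centre G v covers λ i i≢v →
    ¬-not λ vi≡false → isolated⇒disconnected i≢v (isolated i i≢v vi≡false) connected
    where
    isolated : ∀ i → i ≢ v → adj G v i ≡ false → ∀ j → adj G i j ≡ false
    isolated i i≢v eq j with j ≟ᶠ v
    ... | yes refl = trans (adj-sym G i j) eq
    ... | no  j≢v  = covers i j i≢v j≢v

  simpleRoot⇒star : Connected (G *) → RootMultiplicity (indepPoly (G *)) -[1+ 0 ] 1 →
                    ∃ λ m → m ≥ 1 × size G ≡ suc m × G ≅ (K1, m)
  simpleRoot⇒star connected simple = nontrivial (covered⇒star connected (proj₁ covered) (proj₂ covered))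
    where
    p[-1]≡0 : ⟪ sgn , indepPoly (G *) ⟫ ≡ 0ℤ
    p[-1]≡0 = proj₁ (simpleRoot⇒ (indepPoly (G *)) simple)
    covered : ∃ (CoversEdges G)
    covered = decidable-stable (any? (coversEdges? G)) λ ¬covered →
      proj₂ (simpleRoot⇒ (indepPoly (G *)) simple)
        (uncovered⇒multipleRoot (λ stable → edgeless⇒¬root stable p[-1]≡0) (λ v covers → ¬covered (v , covers)))
    K1,0-edgeless : ∀ (i j : Fin 1) → starAdj i j ≡ false
    K1,0-edgeless zero zero = refl
    nontrivial : (∃ λ m → size G ≡ suc m × G ≅ (K1, m)) → ∃ λ m → m ≥ 1 × size G ≡ suc m × G ≅ (K1, m)
    nontrivial (suc m , size≡ , G≅K)       = suc m , s≤s z≤n , size≡ , G≅K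
    -- The vertex of K_{1,0} covers all edges vacuously, but an edgeless graph does not have the
    -- root -1.
    nontrivial (zero  , size≡ , f , f-adj) = contradiction p[-1]≡0
      (edgeless⇒¬root λ i j _ _ → trans (sym (f-adj i j)) (K1,0-edgeless (Inverse.to f i) (Inverse.to f j)))

  star⇒simpleRoot : ∀ {m} → m ≥ 1 → G ≅ (K1, m) → RootMultiplicity (indepPoly (G *)) -[1+ 0 ] 1
  star⇒simpleRoot {suc m} _ G≅K =
    simpleRoot-cong {indepPoly ((K1, suc m) *)} {indepPoly (G *)}
      (indepPoly-cong {(K1, suc m) *} {G *} (corona-cong {K1, suc m} {G} (≅-sym {G} {K1, suc m} G≅K)))
      (simpleRoot-star m)

-- Reading sizes off the independence polynomial

module _ {G : Graph} where
  stable⇒count>0 : ∀ {S k} → Stable G S → ∣ S ∣ ≡ k → 0 < stableCount G k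
  stable⇒count>0 {S} stable eq = ∈-length
    (∈-filter⁺ (λ S → stable? G S ×-dec (∣ S ∣ ℕₚ.≟ _)) (∈-allSubsets S) (stable , eq))

  count>0⇒stable : ∀ {k} → 0 < stableCount G k → ∃ λ S → Stable G S × ∣ S ∣ ≡ k
  count>0⇒stable {k} count>0 = let S , S∈ = inhabitant stables count>0 in
    S , proj₂ (∈-filter⁻ (λ S → stable? G S ×-dec (∣ S ∣ ℕₚ.≟ k)) {xs = allSubsets (size G)} S∈)
    where
    stables = filter (λ S → stable? G S ×-dec (∣ S ∣ ℕₚ.≟ k)) (allSubsets (size G))
    inhabitant : ∀ (xs : List (Subset (size G))) → 0 < length xs → ∃ (_∈ˡ xs)
    inhabitant (x ∷ xs) _ = x , here refl

-- Every subset is disjoint from ⊥, so this is the case A = ⊥ of `Σ⊆-disjoint`.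
Σ⊆-∣∣ : ∀ n u → Σ⊆ n (u ∘ ∣_∣) ≡ steps 1ℤ n u 0
Σ⊆-∣∣ n u = begin
  Σ⊆ n (u ∘ ∣_∣)
    ≡⟨ Σ⊆-cong n (λ B → cong (if_then u ∣ B ∣ else 0ℤ) (dec-true (disjoint? ⊥ B) λ _ i∈⊥ _ → ∉⊥ i∈⊥)) ⟨
  Σ⊆ n (λ B → if does (disjoint? ⊥ B) then u ∣ B ∣ else 0ℤ)
    ≡⟨ Σ⊆-disjoint (⊥ {n}) u ⟩
  steps 1ℤ ∣ ∁ (⊥ {n}) ∣ u 0
    ≡⟨ cong (λ k → steps 1ℤ k u 0) (∣∁⊥∣≡n n) ⟩
  steps 1ℤ n u 0 ∎
  where open ≡-Reasoning

singleton-stable : ∀ G v → Stable G ⁅ v ⁆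
singleton-stable G v i j i∈ j∈ with refl ← x∈⁅y⁆⇒x≡y v i∈ | refl ← x∈⁅y⁆⇒x≡y v j∈ = adj-irrefl G v

-- Singletons are always stable, so dropping the stability test leaves the coefficient of x in
-- (1+x)^n.
stableCount-1 : ∀ G → stableCount G 1 ≡ size G
stableCount-1 G = ℤₚ.+-injective (begin
  + stableCount G 1                       ≡⟨ stableCount-weightSum G 1 ⟩
  weightSum (δ 1) G                       ≡⟨ Σ⊆-cong n singleton ⟩
  Σ⊆ n (λ S → δ 1 ∣ S ∣)                  ≡⟨ Σ⊆-∣∣ n (δ 1) ⟩
  steps 1ℤ n (δ 1) 0                      ≡⟨ steps-δ 1 n 1 ⟩
  + ((n C 1) ℕ.* 1)                       ≡⟨ cong +_ (trans (ℕₚ.*-identityʳ (n C 1)) (nC1≡n n)) ⟩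
  + n                                     ∎)
  where
  open ≡-Reasoning
  n = size G
  singleton : ∀ S → (if does (stable? G S) then δ 1 ∣ S ∣ else 0ℤ) ≡ δ 1 ∣ S ∣
  singleton S = go (∣ S ∣ ℕ.≟ 1)
    where
    go : Dec (∣ S ∣ ≡ 1) → (if does (stable? G S) then δ 1 ∣ S ∣ else 0ℤ) ≡ δ 1 ∣ S ∣
    go (yes eq) = cong (if_then δ 1 ∣ S ∣ else 0ℤ) (dec-true (stable? G S)
      (let v , S≡⁅v⁆ = ∣S∣≡1⇒S≡⁅v⁆ S eq in subst (Stable G) (sym S≡⁅v⁆) (singleton-stable G v)))
    go (no neq) = trans (if-zero (stable? G S) λ _ → δ≡0) (sym δ≡0)
      where
      δ≡0 : δ 1 ∣ S ∣ ≡ 0ℤ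
      δ≡0 = cong (if_then 1ℤ else 0ℤ) (dec-false (∣ S ∣ ℕ.≟ 1) neq)

-- A vertex of `G` and its pendant are adjacent, so each such pair contributes at most one element.
corona-stable-≤ : ∀ G S → Stable (G *) S → ∣ S ∣ ≤ size G
corona-stable-≤ G S stable with A , B , refl ← Vec.splitAt (size G) S = begin
  ∣ A Vec.++ B ∣            ≡⟨ ∣++∣ A B ⟩
  ∣ A ∣ ℕ.+ ∣ B ∣           ≡⟨ ℕₚ.+-comm ∣ A ∣ ∣ B ∣ ⟩
  ∣ B ∣ ℕ.+ ∣ A ∣           ≤⟨ ℕₚ.m≤o∸n⇒m+n≤o ∣ B ∣ (∣p∣≤n A) ∣B∣≤n∸∣A∣ ⟩
  size G                    ∎
  where
  open ℕₚ.≤-Reasoning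
  A#B : Disjoint A B
  A#B = proj₂ (Equivalence.to (stable-corona⇔ G A B) stable)
  ∣B∣≤n∸∣A∣ : ∣ B ∣ ≤ size G ∸ ∣ A ∣
  ∣B∣≤n∸∣A∣ = subst (∣ B ∣ ≤_) (∣∁p∣≡n∸∣p∣ A) (p⊆q⇒∣p∣≤∣q∣ λ i∈B → x∉p⇒x∈∁p λ i∈A → A#B _ i∈A i∈B)

pendants-stable : ∀ G → Stable (G *) (⊥ {size G} Vec.++ ⊤ {size G})
pendants-stable G = Equivalence.from (stable-corona⇔ G ⊥ ⊤) ((λ _ _ i∈⊥ _ → contradiction i∈⊥ ∉⊥) , λ _ i∈⊥ _ → ∉⊥ i∈⊥)

module _ (G T : Graph) (I≈ : indepPoly (G *) ≈P indepPoly T) where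
  count≡ : ∀ k → stableCount (G *) k ≡ stableCount T k
  count≡ k = ℤₚ.+-injective (trans (sym (coeff-indepPoly (G *) k)) (trans (I≈ k) (coeff-indepPoly T k)))

  size-T : size T ≡ size G ℕ.+ size G
  size-T = trans (sym (stableCount-1 T)) (trans (sym (count≡ 1)) (stableCount-1 (G *)))

  -- A stable set of `T` makes the coefficient at its size positive, so `G *` has a stable set of
  -- the same size.
  stable-≤ : ∀ S → Stable T S → ∣ S ∣ ≤ size G
  stable-≤ S stable =
    let S′ , stable′ , ∣S′∣≡ = count>0⇒stable {G *} (subst (0 <_) (sym (count≡ ∣ S ∣)) (stable⇒count>0 {T} stable refl))
    in subst (_≤ size G) ∣S′∣≡ (corona-stable-≤ G S′ stable′)

  maximum-stable : ∃ λ S → Stable T S × ∣ S ∣ ≡ size G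
  maximum-stable = count>0⇒stable {T} (subst (0 <_) (count≡ (size G)) (stable⇒count>0 {G *} (pendants-stable G)
    (trans (∣++∣ (⊥ {size G}) (⊤ {size G})) (cong₂ ℕ._+_ (∣⊥∣≡0 (size G)) (∣⊤∣≡n (size G))))))

-- Maximal stable sets

⊆∧∣∣≥⇒≡ : ∀ {n} {S T : Subset n} → S ⊆ T → ∣ T ∣ ≤ ∣ S ∣ → T ≡ S
⊆∧∣∣≥⇒≡ {S = S} {T} S⊆T ∣T∣≤∣S∣ = ⊆-antisym (λ {i} i∈T → decidable-stable (i ∈? S) λ i∉S →
  ℕₚ.<⇒≱ (p⊂q⇒∣p∣<∣q∣ (S⊆T , i , i∈T , i∉S)) ∣T∣≤∣S∣) S⊆T

extend-to-maximal : ∀ G S → Stable G S → ∃ λ M → MaximalStable G M × S ⊆ M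
extend-to-maximal G S₀ stable₀ = go (size G) S₀ stable₀ (ℕₚ.m≤n+m (size G) ∣ S₀ ∣)
  where
  -- Each enlargement adds a vertex and spends one unit of fuel; once the fuel is gone, S is the
  -- whole vertex set.
  go : ∀ fuel S → Stable G S → size G ≤ ∣ S ∣ ℕ.+ fuel → ∃ λ M → MaximalStable G M × S ⊆ M
  go zero S stable n≤ = S , (stable , λ T _ S⊆T →
    ⊆∧∣∣≥⇒≡ S⊆T (ℕₚ.≤-trans (∣p∣≤n T) (subst (size G ≤_) (ℕₚ.+-identityʳ ∣ S ∣) n≤))) , id
  go (suc fuel) S stable n≤ with anySubset? (λ T → stable? G T ×-dec (S ⊂? T))
  ... | yes (T , stableT , S⊂T) =
    let M , maximal , T⊆M = go fuel T stableT (ℕₚ.≤-trans (subst (size G ≤_) (ℕₚ.+-suc ∣ S ∣ fuel) n≤)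
                                                (ℕₚ.+-monoˡ-≤ fuel (p⊂q⇒∣p∣<∣q∣ S⊂T)))
    in M , maximal , λ i∈S → T⊆M (proj₁ S⊂T i∈S)
  ... | no ¬larger = S , (stable , λ T stableT S⊆T → ⊆∧∣∣≥⇒≡ S⊆T (ℕₚ.≮⇒≥ λ ∣S∣<∣T∣ →
      ¬larger (T , stableT , S⊆T , bigger S⊆T ∣S∣<∣T∣))) , id
    where
    bigger : ∀ {T} → S ⊆ T → ∣ S ∣ < ∣ T ∣ → ∃ λ i → i ∈ T × i ∉ S
    bigger {T} S⊆T ∣S∣<∣T∣ with any? (λ i → (i ∈? T) ×-dec ¬? (i ∈? S))
    ... | yes found = found
    ... | no ¬found = contradiction (p⊆q⇒∣p∣≤∣q∣ λ {i} i∈T → decidable-stable (i ∈? S) λ i∉S → ¬found (i , i∈T , i∉S))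
                                    (ℕₚ.<⇒≱ ∣S∣<∣T∣)

-- A stable set of maximum size is in particular maximal, so well-coveredness compares every other
-- maximal set with it.
maximal-size : ∀ G k → WellCovered G → (∃ λ S → Stable G S × ∣ S ∣ ≡ k) → (∀ S → Stable G S → ∣ S ∣ ≤ k) →
               ∀ M → MaximalStable G M → ∣ M ∣ ≡ k
maximal-size G k wellCovered (S , stable , ∣S∣≡k) bound M maximal = trans (wellCovered M S maximal
  (stable , λ T stableT S⊆T → ⊆∧∣∣≥⇒≡ S⊆T (subst (∣ T ∣ ≤_) (sym ∣S∣≡k) (bound T stableT)))) ∣S∣≡k

-- Matchings in acyclic graphs

unique-prefix : ∀ {A : Set} (xs : List A) {w ys} → Unique (xs List.++ w ∷ ys) → Unique (xs List.++ w ∷ [])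
unique-prefix []       _              = [] ∷ []
unique-prefix (x ∷ xs) (x∉ ∷ unique) =
  All.++⁺ (All.++⁻ˡ xs x∉) (All.head (All.++⁻ʳ xs x∉) ∷ []) ∷ unique-prefix xs unique

-- Cuts a path at `w` and appends the closing edge, in the shape that `HasCycle` requires.
linked-close : ∀ {A : Set} {R : A → A → Set} (xs : List A) {w ys z} → Linked R (xs List.++ w ∷ ys) → R w z →
               Linked R ((xs List.++ w ∷ []) List.++ z ∷ [])
linked-close []            _       Rwz = Rwz ∷ [-]
linked-close (x ∷ [])      (r ∷ l) Rwz = r ∷ linked-close [] l Rwz
linked-close (x ∷ x′ ∷ xs) (r ∷ l) Rwz = r ∷ linked-close (x′ ∷ xs) l Rwz

x∈p-y⇒x≢y : ∀ {n} (p : Subset n) {x y} → x ∈ p - y → x ≢ y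
x∈p-y⇒x≢y (_ ∷ p) {zero}  {zero}  () refl
x∈p-y⇒x≢y (_ ∷ p) {suc x} {suc x} (there x∈) refl = x∈p-y⇒x≢y p x∈ refl

∣p∣≤1+∣p-x∣ : ∀ {n} (p : Subset n) x → ∣ p ∣ ≤ suc ∣ p - x ∣
∣p∣≤1+∣p-x∣ (inside  ∷ p) zero    = s≤s (ℕₚ.≤-reflexive (cong ∣_∣ (sym (p─⊥≡p p))))
∣p∣≤1+∣p-x∣ (outside ∷ p) zero    = ℕₚ.m≤n⇒m≤1+n (ℕₚ.≤-reflexive (cong ∣_∣ (sym (p─⊥≡p p))))
∣p∣≤1+∣p-x∣ (inside  ∷ p) (suc x) = s≤s (∣p∣≤1+∣p-x∣ p x)
∣p∣≤1+∣p-x∣ (outside ∷ p) (suc x) = ∣p∣≤1+∣p-x∣ p x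

module Acyclic (T : Graph) (acyclic : ¬ HasCycle T) where
  private
    V = Fin (size T)
  open DecMembership (_≟ᶠ_ {size T}) using () renaming (_∈?_ to _∈ˡ?_)

  adj-sym′ : ∀ {x y} → Adj T x y → Adj T y x
  adj-sym′ {x} {y} e = trans (adj-sym T y x) e

  adj⇒≢ : ∀ {x y} → Adj T x y → x ≢ y
  adj⇒≢ {x} e refl = contradiction (trans (sym e) (adj-irrefl T x)) λ ()

  no-triangle : ∀ {a b c} → Adj T a b → Adj T b c → ¬ Adj T c a
  no-triangle ab bc ca = acyclic (_ , _ ∷ _ ∷ [] , s≤s (s≤s (s≤s z≤n)) ,
    ((adj⇒≢ ab ∷ adj⇒≢ (adj-sym′ ca) ∷ []) ∷ (adj⇒≢ bc ∷ []) ∷ [] ∷ []) , ab ∷ bc ∷ ca ∷ [-])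

  no-square : ∀ {a b c d} → a ≢ c → b ≢ d → Adj T a b → Adj T b c → Adj T c d → ¬ Adj T d a
  no-square a≢c b≢d ab bc cd da = acyclic (_ , _ ∷ _ ∷ _ ∷ [] , s≤s (s≤s (s≤s z≤n)) ,
    ((adj⇒≢ ab ∷ a≢c ∷ adj⇒≢ (adj-sym′ da) ∷ []) ∷ (adj⇒≢ bc ∷ b≢d ∷ []) ∷ (adj⇒≢ cd ∷ []) ∷ [] ∷ []) ,
    ab ∷ bc ∷ cd ∷ da ∷ [-])

  IsolatedIn LeafIn : Subset (size T) → V → Set
  IsolatedIn U v = ∀ w → w ∈ U → ¬ Adj T v w
  LeafIn U v = ∃ λ y → y ∈ U × Adj T v y × (∀ w → w ∈ U → Adj T v w → w ≡ y)

  low-degree-vertex : ∀ U → Nonempty U → ∃ λ v → v ∈ U × (IsolatedIn U v ⊎ LeafIn U v)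
  low-degree-vertex U (v₀ , v₀∈U) = search (size T) v₀ [] (ℕₚ.≤-reflexive (ℕₚ.+-comm 1 (size T))) ([] ∷ []) [-] (v₀∈U ∷ [])
    where
    -- Extend a path that never turns back; it stops at a vertex of degree at most 1 or closes a cycle.
    search : ∀ fuel v rest → size T < fuel ℕ.+ length (v ∷ rest) → Unique (v ∷ rest) → Linked (Adj T) (v ∷ rest) →
             All (_∈ U) (v ∷ rest) → ∃ λ v → v ∈ U × (IsolatedIn U v ⊎ LeafIn U v)
    -- The fuel runs out only when the path has more than `size T` distinct vertices.
    search zero v rest n< unique _ _ = contradiction
      (subst (length (v ∷ rest) ≤_) (length-tabulate id) (unique-⊆⇒length≤ unique λ {x} _ → ∈-allFin x)) (ℕₚ.<⇒≱ n<)
    search (suc fuel) v [] n< unique linked (v∈U ∷ [])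
      with any? (λ w → (w ∈? U) ×-dec (adj T v w ≟ᵇ true))
    ... | no  ¬nbr = v , v∈U , inj₁ λ w w∈U vw → ¬nbr (w , w∈U , vw)
    ... | yes (w , w∈U , vw) = search fuel w (v ∷ []) (subst (size T <_) (sym (ℕₚ.+-suc fuel 1)) n<)
      ((adj⇒≢ (adj-sym′ vw) ∷ []) ∷ unique) (adj-sym′ vw ∷ linked) (w∈U ∷ v∈U ∷ [])
    search (suc fuel) v (p ∷ ps) n< unique linked@(vp ∷ _) ∈U@(v∈U ∷ p∈U ∷ _)
      with any? (λ w → (w ∈? U) ×-dec (adj T v w ≟ᵇ true) ×-dec ¬? (w ≟ᶠ p))
    ... | no  ¬nbr = v , v∈U , inj₂ (p , p∈U , vp , λ w w∈U vw → decidable-stable (w ≟ᶠ p) λ w≢p → ¬nbr (w , w∈U , vw , w≢p))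
    ... | yes (w , w∈U , vw , w≢p) with w ∈ˡ? ps
    -- The path from v back to w together with the edge vw is a cycle; p lies strictly between them,
    -- so it has at least three vertices.
    ...   | yes w∈ps = contradiction (closes w∈ps) acyclic
      where
      closes : w ∈ˡ ps → HasCycle T
      closes w∈ps with as , bs , refl ← ∈-∃++ w∈ps =
        v , p ∷ as List.++ w ∷ [] ,
        s≤s (s≤s (subst (1 ≤_) (sym (length-++ as)) (ℕₚ.m≤n+m 1 (length as)))) ,
        unique-prefix (v ∷ p ∷ as) unique ,
        linked-close (v ∷ p ∷ as) linked (adj-sym′ vw)
    ...   | no  w∉ps = search fuel w (v ∷ p ∷ ps) (subst (size T <_) (sym (ℕₚ.+-suc fuel _)) n<)
      ((adj⇒≢ (adj-sym′ vw) ∷ w≢p ∷ All.¬Any⇒All¬ ps w∉ps) ∷ unique) (adj-sym′ vw ∷ linked) (w∈U ∷ ∈U)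

  stable-insert : ∀ {S v} → Stable T S → (∀ w → w ∈ S → ¬ Adj T v w) → Stable T (S ∪ ⁅ v ⁆)
  stable-insert {S} {v} stable v#S i j i∈ j∈ with x∈p∪q⁻ S ⁅ v ⁆ i∈ | x∈p∪q⁻ S ⁅ v ⁆ j∈
  ... | inj₁ i∈S | inj₁ j∈S = stable i j i∈S j∈S
  ... | inj₁ i∈S | inj₂ j∈v with refl ← x∈⁅y⁆⇒x≡y v j∈v = ¬-not λ e → v#S i i∈S (adj-sym′ e)
  ... | inj₂ i∈v | inj₁ j∈S with refl ← x∈⁅y⁆⇒x≡y v i∈v = ¬-not (v#S j j∈S)
  ... | inj₂ i∈v | inj₂ j∈v with refl ← x∈⁅y⁆⇒x≡y v i∈v | refl ← x∈⁅y⁆⇒x≡y v j∈v = adj-irrefl T v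

  -- Large stable sets or perfect matchings in forests

  Matching : Subset (size T) → Set
  Matching U = Σ (V → V) λ σ → ∀ x → x ∈ U → σ x ∈ U × σ (σ x) ≡ x × Adj T x (σ x)

  -- A constructive alternative in the spirit of König's theorem. The weak bound accompanies the
  -- matching because an isolated vertex added to U must be able to turn it into a strict one.
  Dichotomy : Subset (size T) → Set
  Dichotomy U = ∃ λ I → I ⊆ U × Stable T I × (∣ U ∣ < ∣ I ∣ ℕ.+ ∣ I ∣ ⊎ (∣ U ∣ ≤ ∣ I ∣ ℕ.+ ∣ I ∣ × Matching U))

  ∣insert∣ : ∀ {S : Subset (size T)} {v} → v ∉ S → suc ∣ S ∣ ≤ ∣ S ∪ ⁅ v ⁆ ∣
  ∣insert∣ {S} {v} v∉S = p⊂q⇒∣p∣<∣q∣ (p⊆p∪q ⁅ v ⁆ , v , x∈p∪q⁺ (inj₂ (x∈⁅x⁆ v)) , v∉S)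

  double-≤ : ∀ {m n a b} → m ≤ suc (suc n) → n ≤ a ℕ.+ a → suc a ≤ b → m ≤ b ℕ.+ b
  double-≤ {m} {n} {a} {b} m≤ n≤ a<b = begin
    m                      ≤⟨ m≤ ⟩
    suc (suc n)            ≤⟨ s≤s (s≤s n≤) ⟩
    suc (suc (a ℕ.+ a))    ≡⟨ cong suc (ℕₚ.+-suc a a) ⟨
    suc a ℕ.+ suc a        ≤⟨ ℕₚ.+-mono-≤ a<b a<b ⟩
    b ℕ.+ b                ∎
    where open ℕₚ.≤-Reasoning

  -- U grows by one vertex and twice the size of I by two, so the excess becomes strict.
  dichotomy-isolated : ∀ {U v} → v ∈ U → IsolatedIn U v → Dichotomy (U - v) → Dichotomy U
  dichotomy-isolated {U} {v} v∈U isolated (I , I⊆ , stable , alternatives) =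
    I ∪ ⁅ v ⁆ , I∪v⊆U , stable-insert stable (λ w w∈I → isolated w (I⊆U w∈I)) ,
    inj₁ (double-≤ (s≤s (∣p∣≤1+∣p-x∣ U v)) ([ ℕₚ.<⇒≤ , proj₁ ]′ alternatives) (∣insert∣ v∉I))
    where
    I⊆U : I ⊆ U
    I⊆U i∈I = p─q⊆p U ⁅ v ⁆ (I⊆ i∈I)
    v∉I : v ∉ I
    v∉I v∈I = x∈p-y⇒x≢y U (I⊆ v∈I) refl
    I∪v⊆U : I ∪ ⁅ v ⁆ ⊆ U
    I∪v⊆U i∈ with x∈p∪q⁻ I ⁅ v ⁆ i∈
    ... | inj₁ i∈I = I⊆U i∈I
    ... | inj₂ i∈v with refl ← x∈⁅y⁆⇒x≡y v i∈v = v∈U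

  -- Both sides of the bound grow by two, so the alternative is inherited: v joins I because its
  -- only neighbour y was deleted, and v and y are matched to each other.
  dichotomy-leaf : ∀ {U v} → v ∈ U → (leaf : LeafIn U v) → Dichotomy (U - v - proj₁ leaf) → Dichotomy U
  dichotomy-leaf {U} {v} v∈U (y , y∈U , vy , only-y) (I , I⊆ , stable , alternatives) =
    I ∪ ⁅ v ⁆ , I∪v⊆U ,
    stable-insert stable (λ w w∈I vw → x∈p-y⇒x≢y (U - v) (I⊆ w∈I) (only-y w (I⊆U w∈I) vw)) ,
    finish alternatives
    where
    U′⊆U : U - v - y ⊆ U
    U′⊆U i∈ = p─q⊆p U ⁅ v ⁆ (p─q⊆p (U - v) ⁅ y ⁆ i∈)
    U′≢v : ∀ {i} → i ∈ U - v - y → i ≢ v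
    U′≢v i∈ = x∈p-y⇒x≢y U (p─q⊆p (U - v) ⁅ y ⁆ i∈)
    U′≢y : ∀ {i} → i ∈ U - v - y → i ≢ y
    U′≢y i∈ = x∈p-y⇒x≢y (U - v) i∈
    I⊆U : I ⊆ U
    I⊆U i∈I = U′⊆U (I⊆ i∈I)
    v∉I : v ∉ I
    v∉I v∈I = U′≢v (I⊆ v∈I) refl
    I∪v⊆U : I ∪ ⁅ v ⁆ ⊆ U
    I∪v⊆U i∈ with x∈p∪q⁻ I ⁅ v ⁆ i∈
    ... | inj₁ i∈I = I⊆U i∈I
    ... | inj₂ i∈v with refl ← x∈⁅y⁆⇒x≡y v i∈v = v∈U
    ∣U∣≤ : ∣ U ∣ ≤ suc (suc ∣ U - v - y ∣)
    ∣U∣≤ = ℕₚ.≤-trans (∣p∣≤1+∣p-x∣ U v) (s≤s (∣p∣≤1+∣p-x∣ (U - v) y))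
    extend : Matching (U - v - y) → Matching U
    extend (σ , σ-matches) = σ′ , σ′-matches
      where
      σ′ : V → V
      σ′ x with x ≟ᶠ v | x ≟ᶠ y
      ... | yes _ | _     = y
      ... | no  _ | yes _ = v
      ... | no  _ | no  _ = σ x
      σ′-v : σ′ v ≡ y
      σ′-v with v ≟ᶠ v | v ≟ᶠ y
      ... | yes _  | _ = refl
      ... | no v≢v | _ = contradiction refl v≢v
      σ′-y : σ′ y ≡ v
      σ′-y with y ≟ᶠ v | y ≟ᶠ y
      ... | yes y≡v | _       = y≡v
      ... | no  _   | yes _   = refl
      ... | no  _   | no  y≢y = contradiction refl y≢y
      σ′-other : ∀ {x} → x ≢ v → x ≢ y → σ′ x ≡ σ x
      σ′-other {x} x≢v x≢y with x ≟ᶠ v | x ≟ᶠ y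
      ... | yes x≡v | _       = contradiction x≡v x≢v
      ... | no  _   | yes x≡y = contradiction x≡y x≢y
      ... | no  _   | no  _   = refl
      σ′-matches : ∀ x → x ∈ U → σ′ x ∈ U × σ′ (σ′ x) ≡ x × Adj T x (σ′ x)
      σ′-matches x x∈U = by-cases (x ≟ᶠ v) (x ≟ᶠ y)
        where
        by-cases : Dec (x ≡ v) → Dec (x ≡ y) → σ′ x ∈ U × σ′ (σ′ x) ≡ x × Adj T x (σ′ x)
        by-cases (yes refl) _ = subst (_∈ U) (sym σ′-v) y∈U , trans (cong σ′ σ′-v) σ′-y , subst (Adj T v) (sym σ′-v) vy
        by-cases (no _) (yes refl) = subst (_∈ U) (sym σ′-y) v∈U , trans (cong σ′ σ′-y) σ′-v , subst (Adj T y) (sym σ′-y) (adj-sym′ vy)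
        by-cases (no x≢v) (no x≢y) =
          let σx∈ , σσx≡x , xσx = σ-matches x (x∈p∧x≢y⇒x∈p-y (x∈p∧x≢y⇒x∈p-y x∈U x≢v) x≢y)
              σ′x≡σx = σ′-other x≢v x≢y
          in subst (_∈ U) (sym σ′x≡σx) (U′⊆U σx∈) ,
             trans (cong σ′ σ′x≡σx) (trans (σ′-other (U′≢v σx∈) (U′≢y σx∈)) σσx≡x) ,
             subst (Adj T x) (sym σ′x≡σx) xσx
    finish : (∣ U - v - y ∣ < ∣ I ∣ ℕ.+ ∣ I ∣ ⊎ (∣ U - v - y ∣ ≤ ∣ I ∣ ℕ.+ ∣ I ∣ × Matching (U - v - y))) →
             ∣ U ∣ < ∣ I ∪ ⁅ v ⁆ ∣ ℕ.+ ∣ I ∪ ⁅ v ⁆ ∣ ⊎ (∣ U ∣ ≤ ∣ I ∪ ⁅ v ⁆ ∣ ℕ.+ ∣ I ∪ ⁅ v ⁆ ∣ × Matching U)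
    finish (inj₁ larger)           = inj₁ (double-≤ (s≤s ∣U∣≤) larger (∣insert∣ v∉I))
    finish (inj₂ (half , matching)) = inj₂ (double-≤ ∣U∣≤ half (∣insert∣ v∉I) , extend matching)

  dichotomy : ∀ U → Dichotomy U
  dichotomy U₀ = go (size T) U₀ (∣p∣≤n U₀)
    where
    go : ∀ fuel U → ∣ U ∣ ≤ fuel → Dichotomy U
    reduce : ∀ fuel {U} → ∣ U ∣ ≤ fuel → (∃ λ v → v ∈ U × (IsolatedIn U v ⊎ LeafIn U v)) → Dichotomy U
    go fuel U ∣U∣≤ with nonempty? U
    ... | yes U≢∅ = reduce fuel ∣U∣≤ (low-degree-vertex U U≢∅)
    ... | no  U≡∅ = ⊥ , (λ i∈⊥ → contradiction i∈⊥ ∉⊥) , (λ _ _ i∈⊥ _ → contradiction i∈⊥ ∉⊥) ,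
      inj₂ (subst (_≤ _) (sym (trans (cong ∣_∣ (Empty-unique U≡∅)) (∣⊥∣≡0 (size T)))) z≤n ,
            id , λ x x∈U → contradiction (x , x∈U) U≡∅)
    reduce zero ∣U∣≤ (v , v∈U , _) = contradiction (ℕₚ.<-≤-trans (x∈p⇒∣p-x∣<∣p∣ v∈U) ∣U∣≤) λ ()
    reduce (suc fuel) {U} ∣U∣≤ (v , v∈U , inj₁ isolated) =
      dichotomy-isolated v∈U isolated (go fuel (U - v) (ℕₚ.≤-pred (ℕₚ.<-≤-trans (x∈p⇒∣p-x∣<∣p∣ v∈U) ∣U∣≤)))
    reduce (suc fuel) {U} ∣U∣≤ (v , v∈U , inj₂ leaf) =
      dichotomy-leaf v∈U leaf (go fuel (U - v - proj₁ leaf)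
        (ℕₚ.≤-trans (∣p─q∣≤∣p∣ (U - v) ⁅ proj₁ leaf ⁆) (ℕₚ.≤-pred (ℕₚ.<-≤-trans (x∈p⇒∣p-x∣<∣p∣ v∈U) ∣U∣≤))))

  -- A stable set with more than half of the 2n vertices would break the bound n, which leaves the
  -- matching.
  perfect-matching : ∀ {n} → size T ≡ n ℕ.+ n → (∀ S → Stable T S → ∣ S ∣ ≤ n) →
                     Σ (V → V) λ σ → (∀ x → σ (σ x) ≡ x) × (∀ x → Adj T x (σ x))
  perfect-matching {n} size≡ bound with dichotomy ⊤
  ... | I , _ , stable , inj₁ larger          = contradiction
    (ℕₚ.≤-trans (ℕₚ.+-mono-≤ (bound I stable) (bound I stable)) (ℕₚ.≤-reflexive (trans (sym size≡) (sym (∣⊤∣≡n (size T)))))) (ℕₚ.<⇒≱ larger)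
  ... | _ , _ , _ , inj₂ (_ , σ , matches) = σ , (λ x → proj₁ (proj₂ (matches x ∈⊤))) , (λ x → proj₂ (proj₂ (matches x ∈⊤)))

-- Well-covered spiders

lookup-injective : ∀ {A : Set} {xs : List A} → Unique xs → ∀ i j → List.lookup xs i ≡ List.lookup xs j → i ≡ j
lookup-injective (_ ∷ _)         zero    zero    _  = refl
lookup-injective (x∉ ∷ _)        zero    (suc j) eq = contradiction eq (All.lookup x∉ (∈-lookup j))
lookup-injective (x∉ ∷ _)        (suc i) zero    eq = contradiction (sym eq) (All.lookup x∉ (∈-lookup i))
lookup-injective (_ ∷ unique)    (suc i) (suc j) eq = cong suc (lookup-injective unique i j eq)

three-neighbours⇒degree≥3 : ∀ G {v a b c} → Adj G v a → Adj G v b → Adj G v c → a ≢ b → a ≢ c → b ≢ c → degree G v ≥ 3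
three-neighbours⇒degree≥3 G {v} {a} {b} {c} va vb vc a≢b a≢c b≢c = unique-⊆⇒length≤
  ((a≢b ∷ a≢c ∷ []) ∷ (b≢c ∷ []) ∷ [] ∷ []) λ
  { (here refl) → neighbour va ; (there (here refl)) → neighbour vb ; (there (there (here refl))) → neighbour vc }
  where
  neighbour : ∀ {x} → Adj G v x → x ∈ˡ filter (λ j → adj G v j ≟ᵇ true) (allFin (size G))
  neighbour {x} vx = ∈-filter⁺ (λ j → adj G v j ≟ᵇ true) (∈-allFin x) vx

one-neighbour⇒degree≤1 : ∀ G {v a} → (∀ b → Adj G v b → b ≡ a) → degree G v ≤ 1
one-neighbour⇒degree≤1 G {v} {a} only-a = unique-⊆⇒length≤ {ys = a ∷ []}
  (Unique.filter⁺ (λ j → adj G v j ≟ᵇ true) (Unique.allFin⁺ (size G)))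
  λ {x} x∈ → here (only-a x (proj₂ (∈-filter⁻ (λ j → adj G v j ≟ᵇ true) {xs = allFin (size G)} x∈)))

-- Leaves in a perfectly matched forest

module PerfectMatching (T : Graph) (acyclic : ¬ HasCycle T) (σ : Fin (size T) → Fin (size T))
  (σσ : ∀ x → σ (σ x) ≡ x) (matched : ∀ x → Adj T x (σ x)) where
  open Acyclic T acyclic

  private
    V = Fin (size T)

  σ-injective : ∀ {x y} → σ x ≡ σ y → x ≡ y
  σ-injective {x} {y} eq = trans (sym (σσ x)) (trans (cong σ eq) (σσ y))

  -- Since `σ x` is always a neighbour of `x`, this says that `x` has degree one.
  Leaf : V → Set
  Leaf x = ∀ a → Adj T x a → a ≡ σ x

  leaf? : ∀ x → Dec (Leaf x)
  leaf? x = all? λ a → (adj T x a ≟ᵇ true) →-dec (a ≟ᶠ σ x)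

  ¬leaf⇒neighbour : ∀ x → ¬ Leaf x → ∃ λ a → Adj T x a × a ≢ σ x
  ¬leaf⇒neighbour x ¬leaf with any? (λ a → (adj T x a ≟ᵇ true) ×-dec ¬? (a ≟ᶠ σ x))
  ... | yes found = found
  ... | no ¬found = contradiction (λ a xa → decidable-stable (a ≟ᶠ σ x) λ a≢σx → ¬found (a , xa , a≢σx)) ¬leaf

  -- S and its image under σ are disjoint because σ moves along edges, and x lies in neither of
  -- them.
  missed-edge-bound : ∀ {S x} → Stable T S → x ∉ S → σ x ∉ S → ∣ S ∣ ℕ.+ ∣ S ∣ < size T
  missed-edge-bound {S} {x} stable x∉S σx∉S = ℕₚ.m≤o∸n⇒m+n≤o (suc ∣ S ∣) (∣p∣≤n S) (begin
    suc ∣ S ∣             ≡⟨ cong suc (∣image∣ π S) ⟨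
    suc ∣ image π S ∣     ≤⟨ p⊂q⇒∣p∣<∣q∣ image⊂∁ ⟩
    ∣ ∁ S ∣               ≡⟨ ∣∁p∣≡n∸∣p∣ S ⟩
    size T ∸ ∣ S ∣        ∎)
    where
    open ℕₚ.≤-Reasoning
    π : V ↔ V
    π = mk↔ₛ′ σ σ σσ σσ
    image⊂∁ : image π S ⊂ ∁ S
    image⊂∁ = (λ {j} j∈ → x∉p⇒x∈∁p λ j∈S → contradiction (trans (sym (matched j)) (stable j (σ j) j∈S (∈-image⁻ π j∈))) λ ()) ,
              x , x∉p⇒x∈∁p x∉S , λ x∈ → σx∉S (∈-image⁻ π x∈)

  -- If neither end of a matching edge is a leaf, a maximal stable set through a further
  -- neighbour of each end misses the edge, so it is too small.
  leaf-alternative : ∀ {n} → size T ≡ n ℕ.+ n → (∀ M → MaximalStable T M → ∣ M ∣ ≡ n) → ∀ x → Leaf x ⊎ Leaf (σ x)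
  leaf-alternative {n} size≡ maximal-size x with leaf? x | leaf? (σ x)
  ... | yes leaf | _        = inj₁ leaf
  ... | no _     | yes leaf = inj₂ leaf
  ... | no ¬leaf | no ¬leaf′ =
    let a , xa , a≢σx = ¬leaf⇒neighbour x ¬leaf
        b , σxb , b≢σσx = ¬leaf⇒neighbour (σ x) ¬leaf′
        b≢x = subst (b ≢_) (σσ x) b≢σσx
        -- An edge ba would close the square a, x, σ x, b; hence {a, b} is stable and can be
        -- extended.
        ¬ba : ¬ Adj T b a
        ¬ba ba = no-square a≢σx (b≢x ∘ sym) (adj-sym′ xa) (matched x) σxb ba
        stable = stable-insert {⁅ a ⁆} {b} (singleton-stable T a) λ w w∈ bw → ¬ba (subst (Adj T b) (x∈⁅y⁆⇒x≡y a w∈) bw)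
        M , maximal , ⊆M = extend-to-maximal T (⁅ a ⁆ ∪ ⁅ b ⁆) stable
        a∈M = ⊆M (x∈p∪q⁺ (inj₁ (x∈⁅x⁆ a)))
        b∈M = ⊆M (x∈p∪q⁺ (inj₂ (x∈⁅x⁆ b)))
        ∣M∣≡n = maximal-size M maximal
    in contradiction (trans (cong₂ ℕ._+_ ∣M∣≡n ∣M∣≡n) (sym size≡))
         (ℕₚ.<⇒≢ (missed-edge-bound (proj₁ maximal) (excludes (proj₁ maximal) xa a∈M) (excludes (proj₁ maximal) σxb b∈M)))
    where
    excludes : ∀ {S y z} → Stable T S → Adj T y z → z ∈ S → y ∉ S
    excludes stable yz z∈S y∈S = contradiction (trans (sym yz) (stable _ _ y∈S z∈S)) λ ()

  module Spider (connected : Connected T) (one-branch : ∀ u v → degree T u ≥ 3 → degree T v ≥ 3 → u ≡ v)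
    (leaf-alt : ∀ x → Leaf x ⊎ Leaf (σ x)) where

    -- A centre need not branch: if no vertex has degree at least 3, the second condition is vacuous
    -- and only the leaf partner counts.
    IsCentre : V → Set
    IsCentre c = Leaf (σ c) × (∀ u → degree T u ≥ 3 → u ≡ c)

    -- A branch vertex is no leaf, so its partner is one. Without a branch vertex, whichever of v
    -- and σ v has a leaf partner will do.
    centre : V → ∃ IsCentre
    centre v with any? (λ u → 3 ℕ.≤? degree T u)
    ... | yes (c , deg≥3) = c ,
      [ (λ leaf → contradiction (one-neighbour⇒degree≤1 T leaf) (ℕₚ.<⇒≱ (ℕₚ.≤-trans (s≤s (s≤s z≤n)) deg≥3))) , id ]′ (leaf-alt c) ,
      λ u deg≥3′ → one-branch u c deg≥3′ deg≥3
    ... | no ¬branch with leaf-alt v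
    ...   | inj₁ leaf = σ v , subst Leaf (sym (σσ v)) leaf , λ u deg≥3 → contradiction (u , deg≥3) ¬branch
    ...   | inj₂ leaf = v , leaf , λ u deg≥3 → contradiction (u , deg≥3) ¬branch

    module _ (c : V) (isCentre : IsCentre c) where
      private
        leaf-σc = proj₁ isCentre
        only-branch = proj₂ isCentre

      Inner : V → Set
      Inner v = Adj T c v × v ≢ σ c

      inner? : ∀ v → Dec (Inner v)
      inner? v = (adj T c v ≟ᵇ true) ×-dec ¬? (v ≟ᶠ σ c)

      inner⇒¬leaf : ∀ {v} → Inner v → ¬ Leaf v
      inner⇒¬leaf {v} (cv , v≢σc) leaf = v≢σc (trans (sym (σσ v)) (cong σ (sym (leaf c (adj-sym′ cv)))))

      inner⇒leaf-σ : ∀ {v} → Inner v → Leaf (σ v)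
      inner⇒leaf-σ {v} inner = [ (λ leaf → contradiction leaf (inner⇒¬leaf inner)) , id ]′ (leaf-alt v)

      -- The four kinds of vertices in the corona of a star: the centre, its pendant, the leaves of
      -- the star and their pendants. The class is closed under adjacency, so connectedness makes it
      -- exhaust `T`.
      data Position (v : V) : Set where
        at-centre : v ≡ c → Position v
        at-pendant : v ≡ σ c → Position v
        at-inner : Inner v → Position v
        at-outer : Inner (σ v) → Position v

      neighbour-position : ∀ {v} → Adj T c v → Position v
      neighbour-position {v} cv with v ≟ᶠ σ c
      ... | yes v≡σc = at-pendant v≡σc
      ... | no  v≢σc = at-inner (cv , v≢σc)

      position-closed : ∀ {v u} → Position v → Adj T v u → Position u
      position-closed (at-centre refl) vu = neighbour-position vu
      position-closed (at-pendant refl) vu = at-centre (trans (leaf-σc _ vu) (σσ c))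
      position-closed {v} {u} (at-inner inner@(cv , v≢σc)) vu with u ≟ᶠ c | u ≟ᶠ σ v
      ... | yes u≡c | _        = at-centre u≡c
      ... | no  _   | yes refl = at-outer (subst Inner (sym (σσ v)) inner)
      -- A third neighbour besides c and σ v would give v degree at least 3 and make it the centre,
      -- to which it is adjacent.
      ... | no  u≢c | no u≢σv  = contradiction (only-branch v
        (three-neighbours⇒degree≥3 T (adj-sym′ cv) (matched v) vu
          (λ c≡σv → v≢σc (trans (sym (σσ v)) (cong σ (sym c≡σv)))) (u≢c ∘ sym) (u≢σv ∘ sym)))
        (adj⇒≢ (adj-sym′ cv))
      position-closed {v} (at-outer inner) vu =
        at-inner (subst Inner (sym (subst Leaf (σσ v) (inner⇒leaf-σ inner) _ vu)) inner)

      position : ∀ v → Position v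
      position v = walk-invariant {T} Position position-closed (connected c v) (at-centre refl)

      inners : List V
      inners = filter inner? (allFin (size T))

      -- The isomorphism from the corona of a star, given an enumeration of the legs

      module _ (legs : ℕ) (leg : Fin legs → V) (leg-inner : ∀ i → Inner (leg i))
        (leg-injective : ∀ i j → leg i ≡ leg j → i ≡ j) (leg-surjective : ∀ {v} → Inner v → ∃ λ i → leg i ≡ v) where

        base : Fin (suc legs) → V
        base zero    = c
        base (suc i) = leg i

        vertex : Fin (suc legs) ⊎ Fin (suc legs) → V
        vertex = [ base , σ ∘ base ]′

        base-leaf : ∀ i → Leaf (σ (base i))
        base-leaf zero    = leaf-σc
        base-leaf (suc i) = inner⇒leaf-σ (leg-inner i)

        base-injective : ∀ i j → base i ≡ base j → i ≡ j
        base-injective zero    zero    _  = refl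
        base-injective zero    (suc j) eq = contradiction eq (adj⇒≢ (proj₁ (leg-inner j)))
        base-injective (suc i) zero    eq = contradiction (sym eq) (adj⇒≢ (proj₁ (leg-inner i)))
        base-injective (suc i) (suc j) eq =
          cong suc (leg-injective i j eq)

        base≢σbase : ∀ i j → base i ≢ σ (base j)
        base≢σbase zero    zero    eq = adj⇒≢ (matched c) eq
        base≢σbase zero    (suc j) eq = proj₂ (leg-inner j) (σ-injective (trans (sym eq) (sym (σσ c))))
        base≢σbase (suc i) j       eq = inner⇒¬leaf (leg-inner i) (subst Leaf (sym eq) (base-leaf j))

        vertex-injective : ∀ s t → vertex s ≡ vertex t → s ≡ t
        vertex-injective (inj₁ i) (inj₁ j) eq = cong inj₁ (base-injective i j eq)
        vertex-injective (inj₁ i) (inj₂ j) eq = contradiction eq (base≢σbase i j)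
        vertex-injective (inj₂ i) (inj₁ j) eq = contradiction (sym eq) (base≢σbase j i)
        vertex-injective (inj₂ i) (inj₂ j) eq = cong inj₂ (base-injective i j (σ-injective eq))

        vertex-surjective : ∀ v → ∃ λ s → vertex s ≡ v
        vertex-surjective v with position v
        ... | at-centre v≡c   = inj₁ zero , sym v≡c
        ... | at-pendant v≡σc = inj₂ zero , sym v≡σc
        ... | at-inner inner  = let i , eq = leg-surjective inner in inj₁ (suc i) , eq
        ... | at-outer inner  = let i , eq = leg-surjective inner in inj₂ (suc i) , trans (cong σ eq) (σσ v)

        base-adj : ∀ i j → adj T (base i) (base j) ≡ starAdj i j
        base-adj zero    zero    = adj-irrefl T c
        base-adj zero    (suc j) = proj₁ (leg-inner j)
        base-adj (suc i) zero    = adj-sym′ (proj₁ (leg-inner i))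
        base-adj (suc i) (suc j) = ¬-not λ ij → no-triangle (proj₁ (leg-inner i)) ij (adj-sym′ (proj₁ (leg-inner j)))

        base-σbase-adj : ∀ i j → adj T (base i) (σ (base j)) ≡ eqB i j
        base-σbase-adj i j with i ≟ᶠ j
        ... | yes refl = matched (base i)
        ... | no  i≢j  = ¬-not λ e → i≢j (base-injective i j (trans (base-leaf j _ (adj-sym′ e)) (σσ (base j))))

        vertex-adj : ∀ s t → adj T (vertex s) (vertex t) ≡ corAdj (K1, legs) s t
        vertex-adj (inj₁ i) (inj₁ j) = base-adj i j
        vertex-adj (inj₁ i) (inj₂ j) = base-σbase-adj i j
        vertex-adj (inj₂ i) (inj₁ j) = trans (adj-sym T _ _) (trans (base-σbase-adj j i) (eqB-sym j i))
        vertex-adj (inj₂ i) (inj₂ j) = ¬-not λ e → base≢σbase i j (sym (trans (base-leaf i _ e) (σσ (base i))))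

        spider-iso : ((K1, legs) *) ≅ T
        spider-iso = bijective⇒↔ (vertex ∘ splitAt (suc legs)) injective surjective ,
          λ x y → vertex-adj (splitAt (suc legs) x) (splitAt (suc legs) y)
          where
          injective : ∀ x y → vertex (splitAt (suc legs) x) ≡ vertex (splitAt (suc legs) y) → x ≡ y
          injective x y eq = trans (sym (join-splitAt (suc legs) (suc legs) x))
            (trans (cong (join (suc legs) (suc legs)) (vertex-injective (splitAt (suc legs) x) (splitAt (suc legs) y) eq))
                   (join-splitAt (suc legs) (suc legs) y))
          surjective : ∀ v → ∃ λ x → vertex (splitAt (suc legs) x) ≡ v
          surjective v = let s , eq = vertex-surjective v in
            join (suc legs) (suc legs) s , trans (cong vertex (splitAt-join (suc legs) (suc legs) s)) eq

      wellCovered-spider-iso : ∃ λ m → ((K1, m) *) ≅ T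
      wellCovered-spider-iso = length inners , spider-iso (length inners) (List.lookup inners)
        (λ i → proj₂ (∈-filter⁻ inner? {xs = allFin (size T)} (∈-lookup i)))
        (lookup-injective (Unique.filter⁺ inner? (Unique.allFin⁺ (size T))))
        (λ {v} inner → let v∈ = ∈-filter⁺ inner? (∈-allFin v) inner in Any.index v∈ , sym (lookup-index v∈))

-- The vertex argument seeds the choice of the centre. It also excludes the empty graph, which meets
-- the other conditions with n = 0 but is not the corona of a star.
wellCovered-spider : ∀ T n → IsSpider T → WellCovered T → size T ≡ n ℕ.+ n → (∀ S → Stable T S → ∣ S ∣ ≤ n) →
  (∃ λ S → Stable T S × ∣ S ∣ ≡ n) → Fin (size T) → ∃ λ m → ((K1, m) *) ≅ T
wellCovered-spider T n ((connected , acyclic) , one-branch) wellCovered size≡ bound maximum v =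
  from-matching (Acyclic.perfect-matching T acyclic size≡ bound)
  where
  from-matching : (Σ (Fin (size T) → Fin (size T)) λ σ → (∀ x → σ (σ x) ≡ x) × (∀ x → Adj T x (σ x))) →
                  ∃ λ m → ((K1, m) *) ≅ T
  from-matching (σ , σσ , matched) = from-centre (centre v)
    where
    open PerfectMatching T acyclic σ σσ matched
    open Spider connected one-branch (leaf-alternative size≡ (maximal-size T n wellCovered maximum bound))
    from-centre : ∃ IsCentre → ∃ λ m → ((K1, m) *) ≅ T
    from-centre (c , isCentre) = wellCovered-spider-iso c isCentre

-- Recovering G from a spider's polynomial

empty-≅ : ∀ {G H} → size G ≡ 0 → size H ≡ 0 → G ≅ H
empty-≅ G≡0 H≡0 = mk↔ₛ′ (λ i → contradiction i (no-vertex G≡0)) (λ i → contradiction i (no-vertex H≡0))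
  (λ i → contradiction i (no-vertex H≡0)) (λ i → contradiction i (no-vertex G≡0)) , λ i → contradiction i (no-vertex G≡0)
  where
  no-vertex : ∀ {n} → n ≡ 0 → ¬ Fin n
  no-vertex refl ()

double-injective : ∀ {m n} → m ℕ.+ m ≡ n ℕ.+ n → m ≡ n
double-injective {m} {n} eq = ℕₚ.*-cancelˡ-≡ m n 2
  (trans (cong (m ℕ.+_) (ℕₚ.+-identityʳ m)) (trans eq (cong (n ℕ.+_) (sym (ℕₚ.+-identityʳ n)))))

-- The simple root shows only that `G` is some star; its size then fixes the number of leaves.
star-from-spider-poly : ∀ G m → Connected (G *) → size G ≡ suc m → indepPoly ((K1, m) *) ≈P indepPoly (G *) → G ≅ (K1, m)
star-from-spider-poly G m connected size≡ I≈ = resize (star m size≡ I≈)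
  where
  resize : (∃ λ k → size G ≡ suc k × G ≅ (K1, k)) → G ≅ (K1, m)
  resize (k , size≡′ , G≅K) = subst (λ k → G ≅ (K1, k)) (ℕₚ.suc-injective (trans (sym size≡′) size≡)) G≅K
  all-equal : ∀ {n} → n ≡ 1 → (i j : Fin n) → i ≡ j
  all-equal refl zero zero = refl
  star : ∀ m → size G ≡ suc m → indepPoly ((K1, m) *) ≈P indepPoly (G *) → ∃ λ k → size G ≡ suc k × G ≅ (K1, k)
  -- For m = 0 the polynomial is 1+2x, which lacks the root -1, so the size alone has to decide.
  star zero size≡1 _ = star-of-centre G (subst Fin (sym size≡1) zero)
    (λ i j i≢v → contradiction (all-equal size≡1 i _) i≢v) (λ i i≢v → contradiction (all-equal size≡1 i _) i≢v)
  star (suc m) _ I≈ = map₂ proj₂ (simpleRoot⇒star G connected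
    (simpleRoot-cong {indepPoly ((K1, suc m) *)} {indepPoly (G *)} I≈ (simpleRoot-star m)))

spider-unique : ∀ G T → Connected (G *) → IsSpider T → WellCovered T → indepPoly (G *) ≈P indepPoly T → (G *) ≅ T
spider-unique G T connected spider wellCovered I≈ = by-size (size G) refl
  where
  size-T≡ : size T ≡ size G ℕ.+ size G
  size-T≡ = size-T G T I≈
  by-size : ∀ n → size G ≡ n → (G *) ≅ T
  -- The corona of the empty graph is vacuously connected; equality of polynomials then makes `T`
  -- empty too.
  by-size zero    eq = empty-≅ {G *} {T} (cong₂ ℕ._+_ eq eq) (trans size-T≡ (cong₂ ℕ._+_ eq eq))
  by-size (suc n) eq = from-star
    (wellCovered-spider T (size G) spider wellCovered size-T≡ (stable-≤ G T I≈) (maximum-stable G T I≈)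
      (subst Fin (sym (trans size-T≡ (cong₂ ℕ._+_ eq eq))) zero))
    where
    from-star : (∃ λ m → ((K1, m) *) ≅ T) → (G *) ≅ T
    from-star (m , K*≅T) = ≅-trans {G *} {(K1, m) *} {T} (corona-cong {G} {K1, m} G≅K) K*≅T
      where
      size-G≡ : size G ≡ suc m
      size-G≡ = double-injective (trans (sym size-T≡) (sym (↔⇒≡ (proj₁ K*≅T))))
      G≅K : G ≅ (K1, m)
      G≅K = star-from-spider-poly G m connected size-G≡ λ k →
        trans (indepPoly-cong {(K1, m) *} {T} K*≅T k) (sym (I≈ k))

theorem5 :
    -- (i)
    (∀ (n : ℕ) → n ≥ 2 →
       indepPoly ((K1, n) *) ≈P (onePlusX *P spiderFactor n))
    ×
    -- (ii)
    (∀ (G : Graph) → Connected (G *) →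
       (RootMultiplicity (indepPoly (G *)) -[1+ 0 ] 1
         ⇔ ∃ λ (n : ℕ) → n ≥ 1 × (G ≅ (K1, n))))
    ×
    -- (iii)
    (∀ (G T : Graph) → Connected (G *) → IsSpider T → WellCovered T →
       indepPoly (G *) ≈P indepPoly T → (G *) ≅ T)
theorem5 =
    (λ { (suc n) _ → indepPoly-spider n })
  , (λ G connected → mk⇔
      (λ simple → map₂ (map₂ proj₂) (simpleRoot⇒star G connected simple))
      (λ (m , m≥1 , G≅K) → star⇒simpleRoot G m≥1 G≅K))
  , spider-unique
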